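{- Parity games where the number $c$ of colours is logarithmically bounded by the number $e$ of vertices with even colour can be solved in polynomial time. That is, for any class of parity games in which $c\in O(\log e)$, there is a polynomial time algorithm that solves the games of this class.
   Context: A parity game is a tuple $(V_e,V_o,E,C,\phi)$, where $V=V_e\cup V_o$ (disjoint union) is a finite set of vertices, $E\subseteq V\times V$ is such that every vertex has at least one outgoing edge, $C\subseteq\{1,2,3,\ldots\}$ is a finite set of colours and $\phi:V\to C$. A token moves along edges; at a vertex of $V_e$ player even chooses the successor, at a vertex of $V_o$ player odd does. An infinite play $v_0,v_1,\ldots$ is won by even iff $\limsup_i\phi(v_i)$ is even, otherwise by odd. Player even wins from $v$ if she has a strategy such that all plays from $v$ consistent with it are won by her. Solving a parity game means determining, for every vertex, which player wins from it. -}

module Defs where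

open import Data.Bool.Base using (Bool; true; false; T)
open import Data.Fin.Base using (Fin; zero)
open import Data.List.Base using (List; []; _∷_; length; filter; allFin; tabulate; applyUpTo)
open import Data.List.Membership.Propositional using (_∈_)
open import Data.List.Relation.Unary.All using (All)
open import Data.List.Relation.Unary.Unique.Propositional using (Unique)
open import Data.Nat.Base using (ℕ; suc; _+_; _*_; _^_; _≤_)
open import Data.Nat.Binary.Base using (ℕᵇ; zero; 2[1+_]; 1+[2_]; fromℕ)
open import Data.Nat.Divisibility using (_∣_; _∣?_)
open import Data.Nat.Logarithm using (⌊log₂_⌋)
open import Data.Product.Base using (∃; ∃-syntax; _×_; proj₁)
open import Data.Vec.Base using (Vec; _∷_; lookup; replicate; _[_]≔_)
open import Level using (Level)
open import Relation.Binary.PropositionalEquality.Core using (_≡_)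
open import Relation.Nullary.Negation.Core using (¬_)
open import Relation.Unary using (Pred)

private
  variable
    ℓ : Level
    A : Set
    k : ℕ

------------------------------------------------------------------------
-- Parity games

data Player : Set where
  even odd : Player

-- The finite set C of colours is a duplicate-free list, and V is Fin n.
record ParityGame : Set where
  field
    n          : ℕ
    owner      : Fin n → Player
    edge       : Fin n → Fin n → Bool
    C          : List ℕ
    φ          : Fin n → ℕ
    total      : ∀ v → ∃[ w ] T (edge v w)
    C-unique   : Unique C
    C-positive : All (1 ≤_) C
    φ∈C        : ∀ v → φ v ∈ C

  V : Set
  V = Fin n

  Edge : V → V → Set
  Edge v w = T (edge v w)

  #colours : ℕ
  #colours = length C

  #evenVertices : ℕ
  #evenVertices = length (filter (λ v → 2 ∣? φ v) (allFin n))

-- c = limsup f for a sequence f of natural numbers: f is eventually at most c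
-- and infinitely often at least c.  "Infinitely often" is stated negatively, so
-- that the existence of a limsup of a bounded sequence is irrefutable without
-- Markov's principle.
IsLimSup : (ℕ → ℕ) → ℕ → Set
IsLimSup f c =
  (∃[ m ] ∀ i → m ≤ i → f i ≤ c) ×
  (∀ m → ¬ ¬ (∃[ i ] (m ≤ i × c ≤ f i)))

EvenLimSup : (ℕ → ℕ) → Set
EvenLimSup f = ∃[ c ] (IsLimSup f c × 2 ∣ c)

module _ (G : ParityGame) where
  open ParityGame G

  IsPlay : (ℕ → V) → Set
  IsPlay ρ = ∀ i → Edge (ρ i) (ρ (suc i))

  -- Even wins iff the limsup is even, and odd wins otherwise.  The limsup of an
  -- arbitrary play is not computable, hence the double negation.
  WonBy : Player → (ℕ → V) → Set
  WonBy even ρ = ¬ ¬ EvenLimSup (λ i → φ (ρ i))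
  WonBy odd  ρ = ¬ EvenLimSup (λ i → φ (ρ i))

  -- A strategy may depend on the whole history: the list holds the vertices
  -- visited before the current one, oldest first.
  Strategy : Player → Set
  Strategy p = List V → (v : V) → owner v ≡ p → ∃[ w ] Edge v w

  Consistent : ∀ {p} → Strategy p → (ℕ → V) → Set
  Consistent {p} σ ρ = ∀ i (o : owner (ρ i) ≡ p) →
    ρ (suc i) ≡ proj₁ (σ (applyUpTo ρ i) (ρ i) o)

  WinsFrom : Player → V → Set
  WinsFrom p v = ∃[ σ ] ∀ ρ →
    IsPlay ρ → ρ 0 ≡ v → Consistent {p} σ ρ → WonBy p ρ

  IsSolution : (V → Player) → Set
  IsSolution W = ∀ v → WinsFrom (W v) v

------------------------------------------------------------------------
-- The model of computation: Jones's language WHILE over binary trees (Jones,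
-- "Computability and Complexity from a Programming Perspective", 1997) with his
-- unit-cost time measure and a primitive conditional added.  The problems
-- it decides in polynomial time are exactly those in PTIME; in particular the
-- unit cost of cons and of copying is harmless, because trees can be shared and
-- the only test is the comparison with nil.

infixr 5 _∙_

data Tree : Set where
  nil : Tree
  _∙_ : Tree → Tree → Tree

size : Tree → ℕ
size nil     = 1
size (s ∙ t) = 1 + (size s + size t)

left right : Tree → Tree
left  nil     = nil
left  (s ∙ _) = s
right nil     = nil
right (_ ∙ t) = t

data Expr (k : ℕ) : Set where
  var   : Fin k → Expr k
  nil   : Expr k
  cons  : Expr k → Expr k → Expr k
  hd tl : Expr k → Expr k

infix  6 _≔_
infixr 5 _⨾_

data Cmd (k : ℕ) : Set where
  _≔_           : Fin k → Expr k → Cmd k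
  _⨾_           : Cmd k → Cmd k → Cmd k
  if_then_else_ : Expr k → Cmd k → Cmd k → Cmd k
  while_loop_     : Expr k → Cmd k → Cmd k

Store : ℕ → Set
Store = Vec Tree

⟦_⟧ : Expr k → Store k → Tree
⟦ var x    ⟧ s = lookup s x
⟦ nil      ⟧ s = nil
⟦ cons a b ⟧ s = ⟦ a ⟧ s ∙ ⟦ b ⟧ s
⟦ hd a     ⟧ s = left (⟦ a ⟧ s)
⟦ tl a     ⟧ s = right (⟦ a ⟧ s)

cost : Expr k → ℕ
cost (var x)    = 1
cost nil        = 1
cost (cons a b) = 1 + (cost a + cost b)
cost (hd a)     = 1 + cost a
cost (tl a)     = 1 + cost a

-- Exec c s s′ t: started in store s, the command c halts in store s′ after t
-- units of time.  In tests nil is false and every other tree is true.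
data Exec {k : ℕ} : Cmd k → Store k → Store k → ℕ → Set where
  assign     : ∀ {x a s} →
               Exec (x ≔ a) s (s [ x ]≔ ⟦ a ⟧ s) (1 + cost a)
  seq        : ∀ {c d s s′ s″ t u} →
               Exec c s s′ t → Exec d s′ s″ u →
               Exec (c ⨾ d) s s″ (t + u)
  if-true    : ∀ {a c d s s′ l r t} → ⟦ a ⟧ s ≡ l ∙ r →
               Exec c s s′ t →
               Exec (if a then c else d) s s′ (1 + cost a + t)
  if-false   : ∀ {a c d s s′ t} → ⟦ a ⟧ s ≡ nil →
               Exec d s s′ t →
               Exec (if a then c else d) s s′ (1 + cost a + t)
  while-true : ∀ {a c s s′ s″ l r t u} → ⟦ a ⟧ s ≡ l ∙ r →
               Exec c s s′ t → Exec (while a loop c) s′ s″ u →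
               Exec (while a loop c) s s″ (1 + cost a + t + u)
  while-done : ∀ {a c s} → ⟦ a ⟧ s ≡ nil →
               Exec (while a loop c) s s (1 + cost a)

-- Variable 0 holds the input at the start and the output at the end; all other
-- variables are initially nil.
record Program : Set where
  constructor program
  field
    {extra} : ℕ
    body    : Cmd (suc extra)

  initial : Tree → Store (suc extra)
  initial input = input ∷ replicate extra nil

  Computes : (input output : Tree) → ℕ → Set
  Computes input output t =
    ∃[ s ] (Exec body (initial input) s t × lookup s zero ≡ output)

------------------------------------------------------------------------
-- Encodings.  Edges are given by the adjacency matrix and colours in binary
-- (as bijective base-2 numerals, least significant digit first).

encodeBool : Bool → Tree
encodeBool false = nil
encodeBool true  = nil ∙ nil

encodePlayer : Player → Tree
encodePlayer even = nil
encodePlayer odd  = nil ∙ nil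

encodeBin : ℕᵇ → Tree
encodeBin zero     = nil
encodeBin 2[1+ b ] = nil ∙ encodeBin b
encodeBin 1+[2 b ] = (nil ∙ nil) ∙ encodeBin b

encodeℕ : ℕ → Tree
encodeℕ m = encodeBin (fromℕ m)

encodeList : (A → Tree) → List A → Tree
encodeList enc []       = nil
encodeList enc (x ∷ xs) = enc x ∙ encodeList enc xs

encodeGame : ParityGame → Tree
encodeGame G =
  encodeList encodePlayer (tabulate owner) ∙
  encodeList (encodeList encodeBool) (tabulate λ v → tabulate (edge v)) ∙
  encodeList encodeℕ C ∙
  encodeList encodeℕ (tabulate φ)
  where open ParityGame G

encodeSolution : (G : ParityGame) → (ParityGame.V G → Player) → Tree
encodeSolution G W = encodeList encodePlayer (tabulate W)

------------------------------------------------------------------------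
-- Classes of games

-- c ∈ O(log e), over all games of the class.
LogBoundedColours : Pred ParityGame ℓ → Set ℓ
LogBoundedColours 𝒞 = ∃[ K ] ∃[ e₀ ] ∀ G → 𝒞 G →
  e₀ ≤ #evenVertices G → #colours G ≤ K * ⌊log₂ #evenVertices G ⌋
  where open ParityGame

-- Every size is at least 1, so bounds of the form a * size ^ d are as general as
-- arbitrary polynomials.  Nothing is required outside the class.
SolvableInPolynomialTime : Pred ParityGame ℓ → Set ℓ
SolvableInPolynomialTime 𝒞 = ∃[ P ] ∃[ a ] ∃[ d ] ∀ G → 𝒞 G →
  ∃[ W ] ∃[ t ]
    ( IsSolution G W
    × Program.Computes P (encodeGame G) (encodeSolution G W) t
    × t ≤ a * size (encodeGame G) ^ d )

{-# OPTIONS --safe #-}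

-- Zielonka's recursion splits the vertices into the winning regions of the two
-- players and yields a progress measure for each of them: a tuple with one
-- component per colour that is bad for the player, which decreases
-- lexicographically along all plays that follow the positional strategy it
-- induces.  For odd only the used even colours are bad, so the number h of
-- components is at most the number of colours and at most the number of even
-- vertices.  The n values of a measure embed, by repeatedly splitting at a
-- median, into strings of length h + l over three letters, where l is about
-- log n.  These are the leaves of a universal tree; there are 3 ^ (h + l) of them,
-- a polynomial number if h ∈ O(log n).  Hence it suffices to solve a safety game:
-- every vertex starts with all strings and loses a string once odd cannot force
-- a move to a vertex with a string that continues the descent.  At the fixed
-- point a vertex retains a string iff odd wins from it: the embedded measure of
-- odd is never removed, and a string retained where even wins would give a play
-- along which the measures of both players descend.

module Submission where

open import Defs
open import Relation.Unary using (Pred; Decidable; ∁; _⊆_)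
open import Data.Bool.Base using (Bool; true; false; T; not; _∧_; _∨_)
  renaming (if_then_else_ to ifᵇ_then_else_)
open import Data.Bool.Properties using (T?; T-∧; T-∨; T-≡; ∧-identityʳ; ∨-identityʳ; ∨-zeroʳ)
open import Data.Empty using (⊥; ⊥-elim)
open import Data.Fin.Base using (Fin; zero; suc)
open import Data.Fin.Patterns
open import Data.Fin.Properties using (any?; all?) renaming (_≟_ to _≟ᶠ_)
open import Data.List.Base using (List; []; _∷_; _++_; length; filter; filterᵇ; foldl; foldr;
  reverse; allFin; tabulate; applyDownFrom) renaming (map to mapˡ; replicate to replicateˡ)
open import Data.List.Properties using (length-++; length-map; length-tabulate; length-reverse;
  length-replicate; length-filter; filter-all; filter-notAll; filter-none;
  id-is-foldr; map-tabulate; reverse-foldl; reverse-involutive)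
open import Data.List.Membership.Propositional using (_∈_; lose)
open import Data.List.Membership.Propositional.Properties using (∈-allFin; ∈-filter⁺; ∈-filter⁻;
  ∈-map⁺; ∈-++⁺ˡ; ∈-++⁺ʳ; ∈-++⁻; ∈-∃++; ∈-applyDownFrom⁺; ∈-tabulate⁺)
open import Data.List.Relation.Unary.All as All using (All)
open import Data.List.Relation.Unary.AllPairs using ([]; _∷_)
open import Data.List.Relation.Unary.Any using (here; there)
open import Data.List.Relation.Unary.Unique.Propositional using (Unique)
import Data.List.Relation.Unary.Unique.Propositional.Properties as Unique
open import Data.Nat.Base hiding (greater; parity)
open import Data.Nat.Binary.Base as ℕᵇ using (ℕᵇ; 2[1+_]; 1+[2_]; toℕ; fromℕ; 0<even; 0<odd;
  even<even; even<odd; odd<even; odd<odd) renaming (zero to 0ᵇ)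
open import Data.Nat.Binary.Properties using (toℕ-fromℕ; fromℕ-mono-<; fromℕ-cancel-<; fromℕ-injective)
open import Data.Nat.Divisibility using (_∣_; _∣?_; m∣m*n; ∣m+n∣m⇒∣n; ∣1⇒≡1)
open import Data.Nat.ListAction using (sum)
open import Data.Nat.Logarithm using (⌊log₂_⌋; ⌊log₂⌊n/2⌋⌋≡⌊log₂n⌋∸1)
open import Data.Nat.Properties renaming (_≟_ to _≟ⁿ_)
open import Data.Product.Base using (∃; ∃-syntax; _×_; _,_; proj₁; proj₂)
open import Data.Sum.Base using (_⊎_; inj₁; inj₂)
open import Data.Unit.Base using (⊤; tt)
open import Data.Vec.Base using (Vec; []; _∷_; head; tail; lookup; map; replicate)
open import Data.Vec.Properties using (lookup-map)
open import Function.Base using (_∘_; id; const; flip)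
open import Function.Bundles using (Equivalence)
open import Relation.Binary.Definitions using (Tri; tri<; tri≈; tri>)
open import Relation.Binary.PropositionalEquality hiding (J)
open import Relation.Nullary hiding (Stable)
open import Relation.Nullary.Decidable using (dec-true; dec-false; decidable-stable)

-- Determinacy with progress measures

-- The recursion is only a device of the proof: the program computes neither regions nor measures,
-- and the entries of a measure may be arbitrarily large. It is enough that the strings, in their
-- fixed order, have room for some measure of odd. The length h + l is what an embedding spends: one
-- `mid` for each of the h levels, and at most l letters `lo` or `hi`, because each of these halves
-- the bound 2 ^ l > n on the number of vectors still to be told apart. The measures of even never
-- reach the program. They only refute strings that survive where even wins, so they can be embedded
-- without economy, with l = n.

select : {P A : Set} → Dec P → A → A → A
select p? x y = ifᵇ does p? then x else y

select-yes : {P A : Set} (p? : Dec P) → P → {x y : A} → select p? x y ≡ x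
select-yes p? p {x} {y} = cong (ifᵇ_then x else y) (dec-true p? p)

select-no : {P A : Set} (p? : Dec P) → ¬ P → {x y : A} → select p? x y ≡ y
select-no p? ¬p {x} {y} = cong (ifᵇ_then x else y) (dec-false p? ¬p)

opponent : Player → Player
opponent even = odd
opponent odd  = even

opponent-involutive : ∀ p → opponent (opponent p) ≡ p
opponent-involutive even = refl
opponent-involutive odd  = refl

infix 4 _≟_
_≟_ : (p q : Player) → Dec (p ≡ q)
even ≟ even = yes refl
even ≟ odd  = no λ ()
odd  ≟ even = no λ ()
odd  ≟ odd  = yes refl

opponent≢ : ∀ p → opponent p ≢ p
opponent≢ even ()
opponent≢ odd ()

≢⇒opponent : ∀ {p q} → p ≢ q → p ≡ opponent q
≢⇒opponent {even} {even} p≢q = ⊥-elim (p≢q refl)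
≢⇒opponent {even} {odd}  p≢q = refl
≢⇒opponent {odd}  {even} p≢q = refl
≢⇒opponent {odd}  {odd}  p≢q = ⊥-elim (p≢q refl)

module _ {A : Set} {P Q : A → Set} (P? : Decidable P) (Q? : Decidable Q) (P⊆Q : P ⊆ Q) where

  length-filter-mono : ∀ xs → length (filter P? xs) ≤ length (filter Q? xs)
  length-filter-mono [] = z≤n
  length-filter-mono (x ∷ xs) with ih ← length-filter-mono xs | P? x | Q? x
  ... | yes _ | yes _ = s≤s ih
  ... | yes p | no ¬q = ⊥-elim (¬q (P⊆Q p))
  ... | no _  | yes _ = m≤n⇒m≤1+n ih
  ... | no _  | no _  = ih

  length-filter-strict : ∀ {x xs} → x ∈ xs → ¬ P x → Q x →
                         length (filter P? xs) < length (filter Q? xs)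
  length-filter-strict {x} {_ ∷ xs} (here refl) ¬p q with P? x | Q? x
  ... | yes p | _     = ⊥-elim (¬p p)
  ... | no _  | yes _ = s≤s (length-filter-mono xs)
  ... | no _  | no ¬q = ⊥-elim (¬q q)
  length-filter-strict {xs = x ∷ _} (there i) ¬p q
    with ih ← length-filter-strict i ¬p q | P? x | Q? x
  ... | yes _ | yes _ = s≤s ih
  ... | yes p | no ¬q = ⊥-elim (¬q (P⊆Q p))
  ... | no _  | yes _ = m≤n⇒m≤1+n ih
  ... | no _  | no _  = ih

-- The progress relation of a measure at an edge whose source has colour c: among
-- the components of index at least c that belong to bad colours, the measure
-- decreases lexicographically, strictly if c itself is bad.  Components are
-- listed from the highest index down.
data Progress (bad : ℕ → Bool) (c : ℕ) : ∀ {d} → Vec ℕ d → Vec ℕ d → Set where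
  done  : Progress bad c [] []
  reach : ∀ {d x y} {xs ys : Vec ℕ d} → bad (suc d) ≡ false → d < c →
          Progress bad c (x ∷ xs) (y ∷ ys)
  skip  : ∀ {d x y} {xs ys : Vec ℕ d} → bad (suc d) ≡ false →
          Progress bad c xs ys → Progress bad c (x ∷ xs) (y ∷ ys)
  drop  : ∀ {d x y} {xs ys : Vec ℕ d} → bad (suc d) ≡ true → y < x →
          Progress bad c (x ∷ xs) (y ∷ ys)
  keep  : ∀ {d x} {xs ys : Vec ℕ d} → bad (suc d) ≡ true → c ≤ d →
          Progress bad c xs ys → Progress bad c (x ∷ xs) (x ∷ ys)

progress-shift : ∀ {bad c d} k {xs ys : Vec ℕ d} → Progress bad c xs ys →
                 Progress bad c (map (k +_) xs) (map (k +_) ys)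
progress-shift k done         = done
progress-shift k (reach b d<c) = reach b d<c
progress-shift k (skip b p)   = skip b (progress-shift k p)
progress-shift k (drop b y<x) = drop b (+-monoʳ-< k y<x)
progress-shift k (keep b c≤d p) = keep b c≤d (progress-shift k p)

-- Which component is the topmost bad one depends on the player and on the colours. A rank written
-- into all components drops there, wherever it is.
progress-replicate : ∀ {bad c} d {x y} → y < x →
                     Progress bad c (replicate d x) (replicate d y)
progress-replicate zero y<x = done
progress-replicate {bad} (suc d) y<x with bad (suc d) in eq
... | true  = drop eq y<x
... | false = skip eq (progress-replicate d y<x)

progress-shift-replicate : ∀ {bad c d} k {y} (xs : Vec ℕ d) → y < k →
                           Progress bad c (map (k +_) xs) (replicate d y)
progress-shift-replicate k [] y<k = done
progress-shift-replicate {bad} {d = suc d} k (x ∷ xs) y<k with bad (suc d) in eq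
... | true  = drop eq (<-≤-trans y<k (m≤m+n k x))
... | false = skip eq (progress-shift-replicate k xs y<k)

module Determinacy (G : ParityGame) where
  open ParityGame G

  size-of : {S : V → Set} → Decidable S → ℕ
  size-of S? = length (filter S? (allFin n))

  data Forces (p : Player) (S Q : V → Set) (v : V) : Set where
    own   : owner v ≡ p → (∃[ w ] Edge v w × S w × Q w) → Forces p S Q v
    other : owner v ≡ opponent p → (∀ w → Edge v w → S w → Q w) → Forces p S Q v

  Arena : (V → Set) → Set
  Arena S = ∀ v → S v → ∃[ w ] Edge v w × S w

  edge? : ∀ v w → Dec (Edge v w)
  edge? v w = T? (edge v w)

  module _ {p : Player} {S Q : V → Set} where

    forces-map : ∀ {Q′ v} → (∀ w → Edge v w → S w → Q w → Q′ w) →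
                 Forces p S Q v → Forces p S Q′ v
    forces-map f (own o (w , e , s , q)) = own o (w , e , s , f w e s q)
    forces-map f (other o g)             = other o λ w e s → f w e s (g w e s)

    forces-const : ∀ {v} → Arena S → S v → (∀ w → Q w) → Forces p S Q v
    forces-const {v} arena s q with owner v ≟ p
    ... | yes o = let w , e , s′ = arena v s in own o (w , e , s′ , q w)
    ... | no ¬o = other (≢⇒opponent ¬o) λ w _ _ → q w

    forces-∃ : ∀ {v} → Arena S → S v → Forces p S Q v → ∃[ w ] Edge v w × S w × Q w
    forces-∃ arena s (own _ x)   = x
    forces-∃ arena s (other _ f) = let w , e , s′ = arena _ s in w , e , s′ , f w e s′

    forces-all : ∀ {v w} → Forces p S Q v → owner v ≡ opponent p → Edge v w → S w → Q w
    forces-all (own refl _) o = ⊥-elim (opponent≢ _ (sym o))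
    forces-all (other _ f)  _ = f _

    module _ (S? : Decidable S) (Q? : Decidable Q) where

      forces? : Decidable (Forces p S Q)
      forces? v with owner v ≟ p
      ... | yes o with any? (λ w → edge? v w ×-dec S? w ×-dec Q? w)
      ...   | yes x = yes (own o x)
      ...   | no ¬x = no λ { (own _ x)   → ¬x x
                           ; (other o′ _) → opponent≢ p (trans (sym o′) o) }
      forces? v | no ¬o with all? (λ w → edge? v w →-dec S? w →-dec Q? w)
      ... | yes f = yes (other (≢⇒opponent ¬o) f)
      ... | no ¬f = no λ { (own o _) → ¬o o ; (other _ f) → ¬f f }

      forces-dual : ∀ {v} → ¬ Forces p S Q v → Forces (opponent p) S (∁ Q) v
      forces-dual {v} ¬F with owner v ≟ p
      ... | yes o = other (trans o (sym (opponent-involutive p)))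
                          λ w e s q → ¬F (own o (w , e , s , q))
      ... | no ¬o with any? (λ w → edge? v w ×-dec S? w ×-dec ¬? (Q? w))
      ...   | yes x = own (≢⇒opponent ¬o) x
      ...   | no ¬x = ⊥-elim (¬F (other (≢⇒opponent ¬o) λ w e s →
                        decidable-stable (Q? w) λ ¬q → ¬x (w , e , s , ¬q)))

  -- The ranks become components of the measures, and `bound` is the amount by which measures
  -- outside the attractor are lifted above those inside.
  record Attractor (p : Player) (S X : V → Set) : Set₁ where
    field
      A         : V → Set
      A?        : Decidable A
      rank      : V → ℕ
      bound     : ℕ
      X⊆A       : ∀ {v} → X v → A v
      rank≤     : ∀ v → rank v ≤ bound
      attracted : ∀ {v} → A v → X v ⊎ Forces p S (λ w → A w × rank w < rank v) v
      closed    : ∀ {v} → S v → ¬ A v → Forces (opponent p) S (∁ A) v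

  module _ (p : Player) {S X : V → Set} (S? : Decidable S) (X? : Decidable X) where

    private
      -- Vertices join one at a time, each with a rank above all earlier ones; `k` is fuel that
      -- exceeds the number of vertices of `S` still outside.
      grow : ∀ k (A : V → Set) (A? : Decidable A) (rank : V → ℕ) (bound : ℕ) →
             (∀ {v} → X v → A v) → (∀ v → rank v ≤ bound) →
             (∀ {v} → A v → X v ⊎ Forces p S (λ w → A w × rank w < rank v) v) →
             size-of (λ v → S? v ×-dec ¬? (A? v)) < k → Attractor p S X
      grow (suc k) A A? rank bound X⊆A rank≤ att (s≤s size≤k)
        with any? (λ v → S? v ×-dec ¬? (A? v) ×-dec forces? {p} S? A? v)
      ... | no ¬ex = record
        { A = A ; A? = A? ; rank = rank ; bound = bound ; X⊆A = X⊆A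
        ; rank≤ = rank≤ ; attracted = att
        ; closed = λ s ¬a → forces-dual S? A? λ F → ¬ex (_ , s , ¬a , F) }
      ... | yes (u , su , ¬au , Fu) =
        grow k A′ A′? rank′ (suc bound) (inj₁ ∘ X⊆A) rank′≤ att′
          (<-≤-trans (length-filter-strict
                        (λ v → S? v ×-dec ¬? (A′? v)) (λ v → S? v ×-dec ¬? (A? v))
                        (λ (s , ¬a) → s , ¬a ∘ inj₁)
                        (∈-allFin u) (λ (_ , ¬a) → ¬a (inj₂ refl)) (su , ¬au))
                     size≤k)
        where
        A′ : V → Set
        A′ v = A v ⊎ v ≡ u

        A′? : Decidable A′
        A′? v = A? v ⊎-dec (v ≟ᶠ u)

        rank′ : V → ℕ
        rank′ v = select (v ≟ᶠ u) (suc bound) (rank v)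

        old : ∀ {v} → A v → rank′ v ≡ rank v
        old {v} a = select-no (v ≟ᶠ u) λ { refl → ¬au a }

        rank′≤ : ∀ v → rank′ v ≤ suc bound
        rank′≤ v with v ≟ᶠ u
        ... | yes _ = ≤-refl
        ... | no _  = m≤n⇒m≤1+n (rank≤ v)

        att′ : ∀ {v} → A′ v → X v ⊎ Forces p S (λ w → A′ w × rank′ w < rank′ v) v
        att′ (inj₁ a) with att a
        ... | inj₁ x = inj₁ x
        ... | inj₂ F = inj₂ (forces-map (λ w _ _ (b , r) →
                         inj₁ b , subst₂ _<_ (sym (old b)) (sym (old a)) r) F)
        att′ (inj₂ refl) = inj₂ (forces-map (λ w _ _ b →
          inj₁ b , subst₂ _<_ (sym (old b)) (sym (select-yes (u ≟ᶠ u) refl)) (s≤s (rank≤ w))) Fu)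

    attractor : Attractor p S X
    attractor = grow _ X X? (const 0) 0 id (λ _ → z≤n) inj₁ ≤-refl

  module _ (bad : Player → ℕ → Bool)
           (exclusive : ∀ p i → bad p i ≡ true → bad (opponent p) i ≡ false)
           (covering : ∀ v → ∃[ p ] bad p (φ v) ≡ true)
           (positive : ∀ v → 1 ≤ φ v) where

    -- The positional strategies are implicit: at a vertex of r, the successor named by `Forces` in
    -- `win` is the move.
    record Solution (d : ℕ) (S : V → Set) : Set where
      field
        W   : V → Player
        μ   : Player → V → Vec ℕ d
        win : ∀ r {v} → S v → W v ≡ r →
              Forces r S (λ w → W w ≡ r × Progress (bad r) (φ v) (μ r v) (μ r w)) v

    private
      -- The top colour harms q, so its opponent p is the one who attracts towards it.
      module Step {d} (q : Player) (bad-q : bad q (suc d) ≡ true) where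

        p = opponent q

        bad-p : bad p (suc d) ≡ false
        bad-p = exclusive q (suc d) bad-q

        module Peel {S : V → Set} (S? : Decidable S) (arena : Arena S)
                    (φ≤ : ∀ {v} → S v → φ v ≤ suc d)
                    (A : Attractor p S (λ v → S v × φ v ≡ suc d)) where

          module A = Attractor A renaming (A to In; A? to in?)

          S′ : V → Set
          S′ v = S v × ¬ A.In v

          S′? : Decidable S′
          S′? v = S? v ×-dec ¬? (A.in? v)

          arena′ : Arena S′
          arena′ v (s , ¬a) =
            let w , e , s′ , ¬a′ = forces-∃ arena s (A.closed s ¬a) in w , e , s′ , ¬a′

          φ≤′ : ∀ {v} → S′ v → φ v ≤ d
          φ≤′ (s , ¬a) = ≤-pred (≤∧≢⇒< (φ≤ s) λ eq → ¬a (A.X⊆A (s , eq)))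

          -- Otherwise the attractor of p would have absorbed v. Hence what q wins in the subgame
          -- `S′` it also wins in `S`.
          escape : ∀ {v w} → S′ v → owner v ≡ p → Edge v w → S w → S′ w
          escape (s , ¬a) o e s′ =
            s′ , forces-all (A.closed s ¬a) (trans o (sym (opponent-involutive p))) e s′

          module Regions (sol′ : Solution d S′) where
            open Solution sol′ renaming (W to W′; μ to μ′; win to win′)

            -- The opponent q may move from S′ into the attractor, so the
            -- attractor gets the lower measures.
            all-p : (∀ {v} → S′ v → W′ v ≢ q) → Solution (suc d) S
            all-p none = record { W = const p ; μ = const μ ; win = win }
              where
              μ : V → Vec ℕ (suc d)
              -- The 0 fills the component of the top colour, which is good for p and is never
              -- compared.
              μ v = select (A.in? v) (replicate _ (A.rank v))
                                     (map (suc A.bound +_) (0 ∷ μ′ p v))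

              in-A : ∀ {v} → A.In v → μ v ≡ replicate _ (A.rank v)
              in-A a = select-yes (A.in? _) a

              not-A : ∀ {v} → ¬ A.In v → μ v ≡ map (suc A.bound +_) (0 ∷ μ′ p v)
              not-A ¬a = select-no (A.in? _) ¬a

              Q : V → V → Set
              Q v w = p ≡ p × Progress (bad p) (φ v) (μ v) (μ w)

              remain : ∀ {v w} → ¬ A.In v → ¬ A.In w →
                       Progress (bad p) (φ v) (μ′ p v) (μ′ p w) → Q v w
              remain ¬a ¬b pr = refl , subst₂ (Progress _ _) (sym (not-A ¬a)) (sym (not-A ¬b))
                (progress-shift (suc A.bound) (skip bad-p pr))

              enter : ∀ {v w} → ¬ A.In v → A.In w → Q v w
              enter {v} {w} ¬a b = refl , subst₂ (Progress _ _) (sym (not-A ¬a)) (sym (in-A b))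
                (progress-shift-replicate _ (0 ∷ μ′ p v) (s≤s (A.rank≤ w)))

              win-p : ∀ {v} → S v → Forces p S (Q v) v
              win-p {v} s = by-region (A.in? v)
                where
                reach-top : (xs ys : Vec ℕ (suc d)) → d < φ v → Progress (bad p) (φ v) xs ys
                reach-top (_ ∷ _) (_ ∷ _) = reach bad-p

                leave : ∀ {w} → ¬ A.In v → (S′ w → Progress (bad p) (φ v) (μ′ p v) (μ′ p w)) →
                        S w → Dec (A.In w) → Q v w
                leave ¬a f s′ (yes b) = enter ¬a b
                leave ¬a f s′ (no ¬b) = remain ¬a ¬b (f (s′ , ¬b))

                by-region : Dec (A.In v) → Forces p S (Q v) v
                by-region (yes a) with A.attracted a
                -- At a vertex of the top colour every move is progress for p, since no bad
                -- component has index `suc d` or more.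
                ... | inj₁ (_ , eq) = forces-const arena s λ w →
                        refl , reach-top (μ v) (μ w) (≤-reflexive (sym eq))
                ... | inj₂ F = forces-map (λ w _ _ (b , r) →
                        refl , subst₂ (Progress _ _) (sym (in-A a)) (sym (in-A b))
                                 (progress-replicate _ r)) F
                by-region (no ¬a) with win′ p (s , ¬a) (≢⇒opponent (none (s , ¬a)))
                ... | own o (w , e , s′ , _ , pr) =
                        own o (w , e , proj₁ s′ , remain ¬a (proj₂ s′) pr)
                ... | other o f = other o λ w e s′ →
                        leave ¬a (λ t → proj₂ (f w e t)) s′ (A.in? w)

              win : ∀ r {v} → S v → p ≡ r →
                    Forces r S (λ w → p ≡ r × Progress (bad r) (φ v) (μ v) (μ w)) v
              win r s refl = win-p s

            X : V → Set
            X v = S′ v × W′ v ≡ q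

            X? : Decidable X
            X? v = S′? v ×-dec (W′ v ≟ q)

            module Split (B : Attractor q S X) where

              module B = Attractor B renaming (A to In; A? to in?)

              S″ : V → Set
              S″ v = S v × ¬ B.In v

              S″? : Decidable S″
              S″? v = S? v ×-dec ¬? (B.in? v)

              arena″ : Arena S″
              arena″ v (s , ¬b) =
                let w , e , s′ , ¬b′ = forces-∃ arena s (B.closed s ¬b) in w , e , s′ , ¬b′

              smaller : ∀ {v} → X v → size-of S″? < size-of S?
              smaller {v} x = length-filter-strict S″? S? proj₁ (∈-allFin v)
                (λ (_ , ¬b) → ¬b (B.X⊆A x)) (proj₁ (proj₁ x))

              module Merge (sol″ : Solution (suc d) S″) where
                open Solution sol″ renaming (W to W″; μ to μ″; win to win″)

                W : V → Player
                W v = select (B.in? v) q (W″ v)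

                -- The head component belongs to the bad colour suc d and orders X
                -- below the layers of its attractor and those below S″.
                μ-B μ-q : V → Vec ℕ (suc d)
                μ-B v = select (X? v) (0 ∷ μ′ q v) (replicate _ (B.rank v))
                μ-q v = select (B.in? v) (μ-B v) (map (suc B.bound +_) (μ″ q v))

                μ : Player → V → Vec ℕ (suc d)
                μ r = select (r ≟ q) μ-q (μ″ p)

                W-in : ∀ {v} → B.In v → W v ≡ q
                W-in b = select-yes (B.in? _) b

                W-out : ∀ {v} → ¬ B.In v → W v ≡ W″ v
                W-out ¬b = select-no (B.in? _) ¬b

                q-X : ∀ {v} → X v → μ-q v ≡ 0 ∷ μ′ q v
                q-X x = trans (select-yes (B.in? _) (B.X⊆A x)) (select-yes (X? _) x)

                q-attracted : ∀ {v} → B.In v → ¬ X v → μ-q v ≡ replicate _ (B.rank v)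
                q-attracted b ¬x = trans (select-yes (B.in? _) b) (select-no (X? _) ¬x)

                q-out : ∀ {v} → ¬ B.In v → μ-q v ≡ map (suc B.bound +_) (μ″ q v)
                q-out ¬b = select-no (B.in? _) ¬b

                q-head : ∀ {w} → B.In w → ∃[ x ] ∃[ xs ] μ-q w ≡ x ∷ xs × x ≤ B.rank w
                q-head {w} b with X? w
                ... | yes x = _ , _ , q-X x , z≤n
                ... | no ¬x = _ , _ , q-attracted b ¬x , ≤-refl

                drop-to : ∀ {c w} (xs : Vec ℕ (suc d)) → B.In w → B.rank w < head xs →
                          Progress (bad q) c xs (μ-q w)
                drop-to (x ∷ _) b r with q-head b
                ... | y , _ , eq , y≤ = subst (Progress _ _ _) (sym eq) (drop bad-q (≤-<-trans y≤ r))

                Qq : V → V → Set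
                Qq v w = W w ≡ q × Progress (bad q) (φ v) (μ-q v) (μ-q w)

                shift-q : ∀ {v w} → ¬ B.In v → ¬ B.In w → W″ w ≡ q ×
                          Progress (bad q) (φ v) (μ″ q v) (μ″ q w) → Qq v w
                shift-q ¬b ¬b′ (eq , pr) = trans (W-out ¬b′) eq ,
                  subst₂ (Progress _ _) (sym (q-out ¬b)) (sym (q-out ¬b′)) (progress-shift _ pr)

                win-q : ∀ {v} → S v → W v ≡ q → Forces q S (Qq v) v
                win-q {v} s eq = by-region (B.in? v) (X? v)
                  where
                  low : ∀ {w} (xs : Vec ℕ (suc d)) → B.rank w < head (map (suc B.bound +_) xs)
                  low {w} (x ∷ _) = s≤s (≤-trans (B.rank≤ w) (m≤m+n _ x))

                  leave : ∀ {w} → ¬ B.In v → S w → Dec (B.In w) →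
                          (S″ w → W″ w ≡ q × Progress (bad q) (φ v) (μ″ q v) (μ″ q w)) → Qq v w
                  leave ¬b s′ (yes b) f = W-in b ,
                    subst (λ xs → Progress _ _ xs _) (sym (q-out ¬b)) (drop-to _ b (low (μ″ q v)))
                  leave ¬b s′ (no ¬b′) f = shift-q ¬b ¬b′ (f (s′ , ¬b′))

                  step : ∀ {w} → X v → S′ w →
                         W′ w ≡ q × Progress (bad q) (φ v) (μ′ q v) (μ′ q w) → Qq v w
                  step x t (eq″ , pr) = W-in (B.X⊆A (t , eq″)) ,
                    subst₂ (Progress _ _) (sym (q-X x)) (sym (q-X (t , eq″)))
                      -- Colours in `S′` are at most d, so the head component may stay at 0 inside
                      -- `X`.
                      (keep bad-q (φ≤′ (proj₁ x)) pr)

                  by-region : Dec (B.In v) → Dec (X v) → Forces q S (Qq v) v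
                  by-region (no ¬b) _ with win″ q (s , ¬b) (trans (sym (W-out ¬b)) eq)
                  ... | own o (w , e , (s′ , ¬b′) , x) = own o (w , e , s′ , shift-q ¬b ¬b′ x)
                  ... | other o f = other o λ w e s′ → leave ¬b s′ (B.in? w) (f w e)
                  by-region (yes b) (no ¬x) with B.attracted b
                  ... | inj₁ x = ⊥-elim (¬x x)
                  ... | inj₂ F = forces-map (λ w _ _ (b′ , r) → W-in b′ ,
                          subst (λ xs → Progress _ _ xs _) (sym (q-attracted b ¬x))
                            (drop-to (replicate _ (B.rank v)) b′ r)) F
                  by-region (yes b) (yes x@(s′ , eq′)) with win′ q s′ eq′
                  ... | own o (w , e , t , y) = own o (w , e , proj₁ t , step x t y)
                  ... | other o f = other o λ w e t →
                          let t′ = escape s′ o e t in step x t′ (f w e t′)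

                -- The measure of p carries over unchanged: inside `B` p wins nowhere, and from
                -- outside q cannot enter its own attractor.
                win-p : ∀ {v} → S v → W v ≡ p →
                        Forces p S (λ w → W w ≡ p × Progress (bad p) (φ v) (μ″ p v) (μ″ p w)) v
                win-p {v} s eq = by-region (B.in? v)
                  where
                  by-region : Dec (B.In v) → Forces p S _ v
                  by-region (yes b) = ⊥-elim (opponent≢ q (trans (sym eq) (W-in b)))
                  by-region (no ¬b) with win″ p (s , ¬b) (trans (sym (W-out ¬b)) eq)
                  ... | own o (w , e , (s′ , ¬b′) , eq′ , pr) =
                          own o (w , e , s′ , trans (W-out ¬b′) eq′ , pr)
                  ... | other o f = other o λ w e s′ →
                          let ¬b′ = forces-all (B.closed s ¬b) o e s′
                              eq′ , pr = f w e (s′ , ¬b′)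
                          in trans (W-out ¬b′) eq′ , pr

                win : ∀ r {v} → S v → W v ≡ r →
                      Forces r S (λ w → W w ≡ r × Progress (bad r) (φ v) (μ r v) (μ r w)) v
                win r s eq with r ≟ q
                ... | yes refl = win-q s eq
                ... | no ¬q with refl ← ≢⇒opponent ¬q = win-p s eq

                merged : Solution (suc d) S
                merged = record { W = W ; μ = μ ; win = win }

    zielonka : ∀ d {S : V → Set} (S? : Decidable S) → Arena S →
               (∀ {v} → S v → φ v ≤ d) → Solution d S

    private
      -- The second recursive call, on `S″`, keeps the top colour; it removes at least the nonempty
      -- `X`, whence the inner induction on the size of the arena.
      by-size : ∀ {d} q → bad q (suc d) ≡ true → ∀ k {S : V → Set} (S? : Decidable S) →
                Arena S → (∀ {v} → S v → φ v ≤ suc d) → size-of S? < k → Solution (suc d) S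
      by-size {d} q b (suc k) S? arena φ≤ (s≤s size≤k) = by-region (any? Y.X?)
        where
        module Z = Step.Peel q b S? arena φ≤
          (attractor (opponent q) S? (λ v → S? v ×-dec (φ v ≟ⁿ suc d)))
        module Y = Z.Regions (zielonka d Z.S′? Z.arena′ Z.φ≤′)
        module B = Y.Split (attractor q S? Y.X?)
        by-region : Dec (∃ Y.X) → Solution (suc d) _
        by-region (yes (u , x)) = B.Merge.merged
          (by-size q b k B.S″? B.arena″ (φ≤ ∘ proj₁) (<-≤-trans (B.smaller x) size≤k))
        by-region (no none) = Y.all-p λ s eq → none (_ , s , eq)

    zielonka zero S? arena φ≤ = record
      { W = const even ; μ = λ _ _ → []
      ; win = λ r {v} s _ → ⊥-elim (<⇒≱ (positive v) (φ≤ s)) }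
    zielonka (suc d) {S} S? arena φ≤ with bad even (suc d) in be | bad odd (suc d) in bo
    ... | true  | _     = by-size even be _ S? arena φ≤ ≤-refl
    ... | false | true  = by-size odd bo _ S? arena φ≤ ≤-refl
    ... | false | false = record
      { W = W ; μ = λ p v → 0 ∷ μ p v
      ; win = λ r s eq → forces-map (λ _ _ _ (eq′ , pr) → eq′ , skip (good r) pr) (win r s eq) }
      where
      good : ∀ r → bad r (suc d) ≡ false
      good even = be
      good odd  = bo
      φ≤′ : ∀ {v} → S v → φ v ≤ d
      φ≤′ {v} s = ≤-pred (≤∧≢⇒< (φ≤ s) λ eq →
        let p , b = covering v in case-absurd (trans (sym b) (trans (cong (bad p) eq) (good p))))
        where
        case-absurd : true ≡ false → ⊥
        case-absurd ()
      open Solution (zielonka d S? arena φ≤′)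

-- Counting bad colours

unique-⊆-length : {A : Set} {xs ys : List A} → Unique xs → (∀ {x} → x ∈ xs → x ∈ ys) →
                  length xs ≤ length ys
unique-⊆-length [] _ = z≤n
unique-⊆-length {xs = x ∷ xs} (x∉ ∷ u) xs⊆ with ∈-∃++ (xs⊆ (here refl))
... | as , bs , refl = begin
  suc (length xs)               ≤⟨ s≤s (unique-⊆-length u rest) ⟩
  suc (length (as ++ bs))       ≡⟨ cong suc (length-++ as) ⟩
  suc (length as + length bs)   ≡⟨ +-suc (length as) (length bs) ⟨
  length as + suc (length bs)   ≡⟨ length-++ as ⟨
  length (as ++ x ∷ bs)         ∎
  where
  open ≤-Reasoning
  rest : ∀ {y} → y ∈ xs → y ∈ as ++ bs
  rest {y} y∈ with ∈-++⁻ as (xs⊆ (there y∈))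
  ... | inj₁ i           = ∈-++⁺ˡ i
  ... | inj₂ (here refl) = ⊥-elim (All.lookup x∉ y∈ refl)
  ... | inj₂ (there i)   = ∈-++⁺ʳ as i

bit : Bool → ℕ
bit false = 0
bit true  = 1

tally : (ℕ → Bool) → ℕ → ℕ
tally P d = length (filterᵇ P (applyDownFrom suc d))

tally-suc : ∀ P d → tally P (suc d) ≡ bit (P (suc d)) + tally P d
tally-suc P d with P (suc d)
... | true  = refl
... | false = refl

tally-none : ∀ P d → (∀ i → i ≤ d → P i ≡ false) → tally P d ≡ 0
tally-none P zero none = refl
tally-none P (suc d) none = trans (tally-suc P d)
  (cong₂ _+_ (cong bit (none (suc d) ≤-refl)) (tally-none P d λ i i≤d → none i (m≤n⇒m≤1+n i≤d)))

-- Translates a count over the indices of a measure, on which the inductions run, into a count over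
-- the list of colours, which the program has at hand.
tally-unique : ∀ P d {xs} → Unique xs → (∀ i → T (P i) → i ∈ xs × 1 ≤ i × i ≤ d) →
               tally P d ≡ length (filterᵇ P xs)
tally-unique P d {xs} u sat = ≤-antisym
  (unique-⊆-length (Unique.filter⁺ P? (Unique.applyDownFrom⁺₁ suc d λ j<i _ → <⇒≢ j<i ∘ sym ∘ suc-injective))
    λ i∈ → let p = proj₂ (∈-filter⁻ P? {xs = applyDownFrom suc d} i∈) in
           ∈-filter⁺ P? (proj₁ (sat _ p)) p)
  (unique-⊆-length (Unique.filter⁺ P? u)
    λ i∈ → let p = proj₂ (∈-filter⁻ P? {xs = xs} i∈) in ∈-filter⁺ P? (below p (sat _ p)) p)
  where
  P? = T? ∘ P
  below : ∀ {i} → T (P i) → i ∈ xs × 1 ≤ i × i ≤ d → i ∈ applyDownFrom suc d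
  below {suc i} _ (_ , _ , i≤d) = ∈-applyDownFrom⁺ suc i≤d

-- The number of tree levels on which codes are compared at a vertex of colour c; the smaller the
-- colour, the deeper the comparison.
depth : (ℕ → Bool) → ℕ → ℕ → ℕ
depth bad c d = tally (λ i → bad i ∧ (c ≤ᵇ i)) d

depth-anti : ∀ bad d {c c′} → c ≤ c′ → depth bad c′ d ≤ depth bad c d
depth-anti bad d c≤c′ = length-filter-mono _ _
  (λ t → let b , le = Equivalence.to T-∧ t in
         Equivalence.from T-∧ (b , ≤⇒≤ᵇ (≤-trans c≤c′ (≤ᵇ⇒≤ _ _ le)))) (applyDownFrom suc d)

module _ (bad : ℕ → Bool) {d : ℕ} where

  depth-good : ∀ c → bad (suc d) ≡ false → depth bad c (suc d) ≡ depth bad c d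
  depth-good c b = trans (tally-suc _ d) (cong (λ x → bit (x ∧ (c ≤ᵇ suc d)) + depth bad c d) b)

  depth-bad : ∀ {c} → bad (suc d) ≡ true → c ≤ suc d → depth bad c (suc d) ≡ suc (depth bad c d)
  depth-bad {c} b c≤ = trans (tally-suc _ d)
    (cong₂ (λ x y → bit (x ∧ y) + depth bad c d) b (Equivalence.to T-≡ (≤⇒≤ᵇ c≤)))

depth-above : ∀ bad {d c} → d < c → depth bad c d ≡ 0
depth-above bad {d} {c} d<c = tally-none _ d λ i i≤d → none i (<⇒≱ (≤-<-trans i≤d d<c))
  where
  none : ∀ i → ¬ c ≤ i → bad i ∧ (c ≤ᵇ i) ≡ false
  none i ¬c≤i with bad i | c ≤ᵇ i in eq
  ... | false | _     = refl
  ... | true  | false = refl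
  ... | true  | true  = ⊥-elim (¬c≤i (≤ᵇ⇒≤ c i (subst T (sym eq) tt)))

-- Codes

data Digit : Set where
  lo mid hi : Digit

Code : ℕ → Set
Code = Vec Digit

-- A code is a path in a binary search tree of binary search trees: lo and hi
-- branch inside one level, mid descends to the next level.  Thus the prefix up
-- to the j-th mid names a node of level j, and two codes are compared
-- lexicographically on these prefixes; r is the verdict on equal prefixes.
descends : ∀ {m} → Bool → ℕ → Code m → Code m → Bool
descends r zero    _         _         = r
descends r (suc j) []        []        = false
descends r (suc j) (lo  ∷ x) (lo  ∷ y) = descends r (suc j) x y
descends r (suc j) (lo  ∷ x) (mid ∷ y) = false
descends r (suc j) (lo  ∷ x) (hi  ∷ y) = false
descends r (suc j) (mid ∷ x) (lo  ∷ y) = true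
descends r (suc j) (mid ∷ x) (mid ∷ y) = descends r j x y
descends r (suc j) (mid ∷ x) (hi  ∷ y) = false
descends r (suc j) (hi  ∷ x) (lo  ∷ y) = true
descends r (suc j) (hi  ∷ x) (mid ∷ y) = true
descends r (suc j) (hi  ∷ x) (hi  ∷ y) = descends r (suc j) x y

-- The code read as a ternary number, with all digits after the j-th `mid` replaced by 0. It maps
-- the tree order of level j into the natural numbers, where infinite descent is refuted.
value : ∀ {m} → ℕ → Code m → ℕ
value zero _ = 0
value (suc j) [] = 0
value (suc j) (lo ∷ x) = value (suc j) x
value {suc m} (suc j) (mid ∷ x) = 3 ^ m + value j x
value {suc m} (suc j) (hi  ∷ x) = 3 ^ m + (3 ^ m + value (suc j) x)

value< : ∀ {m} j (x : Code m) → value j x < 3 ^ m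
value< {m} zero x = m^n>0 3 m
value< (suc j) [] = s≤s z≤n
value< {suc m} (suc j) (lo ∷ x) = <-≤-trans (value< (suc j) x) (m≤m+n (3 ^ m) _)
value< {suc m} (suc j) (mid ∷ x) = +-monoʳ-< (3 ^ m) (<-≤-trans (value< j x) (m≤m+n (3 ^ m) _))
value< {suc m} (suc j) (hi ∷ x) = +-monoʳ-< (3 ^ m) (+-monoʳ-< (3 ^ m)
  (<-≤-trans (value< (suc j) x) (m≤m+n (3 ^ m) 0)))

-- A lexicographic descent on long prefixes is at least a weak one on shorter prefixes. So vertices
-- of smaller colour, which compare more levels, never undo the descent at the limsup.
descends⇒≤ : ∀ {m r j k} (x y : Code m) → k ≤ j → T (descends r j x y) → value k y ≤ value k x
descends⇒≤ {k = zero} _ _ _ _ = z≤n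
descends⇒≤ {j = suc j} {suc k} [] [] k≤j ()
descends⇒≤ {j = suc j} {suc k} (lo ∷ x) (lo ∷ y) k≤j t = descends⇒≤ x y k≤j t
descends⇒≤ {suc m} {j = suc j} {suc k} (mid ∷ x) (lo ∷ y) k≤j t =
  ≤-trans (<⇒≤ (value< (suc k) y)) (m≤m+n (3 ^ m) _)
descends⇒≤ {suc m} {j = suc j} {suc k} (mid ∷ x) (mid ∷ y) (s≤s k≤j) t =
  +-monoʳ-≤ (3 ^ m) (descends⇒≤ x y k≤j t)
descends⇒≤ {suc m} {j = suc j} {suc k} (hi ∷ x) (lo ∷ y) k≤j t =
  ≤-trans (<⇒≤ (value< (suc k) y)) (m≤m+n (3 ^ m) _)
descends⇒≤ {suc m} {j = suc j} {suc k} (hi ∷ x) (mid ∷ y) k≤j t =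
  +-monoʳ-≤ (3 ^ m) (≤-trans (<⇒≤ (value< k y)) (m≤m+n (3 ^ m) _))
descends⇒≤ {suc m} {j = suc j} {suc k} (hi ∷ x) (hi ∷ y) k≤j t =
  +-monoʳ-≤ (3 ^ m) (+-monoʳ-≤ (3 ^ m) (descends⇒≤ x y k≤j t))

descends⇒< : ∀ {m} j (x y : Code m) → T (descends false j x y) → value j y < value j x
descends⇒< (suc j) [] [] ()
descends⇒< (suc j) (lo ∷ x) (lo ∷ y) t = descends⇒< (suc j) x y t
descends⇒< {suc m} (suc j) (mid ∷ x) (lo ∷ y) t = <-≤-trans (value< (suc j) y) (m≤m+n (3 ^ m) _)
descends⇒< {suc m} (suc j) (mid ∷ x) (mid ∷ y) t = +-monoʳ-< (3 ^ m) (descends⇒< j x y t)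
descends⇒< {suc m} (suc j) (hi ∷ x) (lo ∷ y) t = <-≤-trans (value< (suc j) y) (m≤m+n (3 ^ m) _)
descends⇒< {suc m} (suc j) (hi ∷ x) (mid ∷ y) t =
  +-monoʳ-< (3 ^ m) (<-≤-trans (value< j y) (m≤m+n (3 ^ m) _))
descends⇒< {suc m} (suc j) (hi ∷ x) (hi ∷ y) t =
  +-monoʳ-< (3 ^ m) (+-monoʳ-< (3 ^ m) (descends⇒< (suc j) x y t))

-- The embedding of measures into codes

module _ {A : Set} {P Q : A → Set} (P? : Decidable P) (Q? : Decidable Q)
         (disjoint : ∀ {x} → P x → ¬ Q x) where

  length-filter-disjoint : ∀ xs → length (filter P? xs) + length (filter Q? xs) ≤ length xs
  length-filter-disjoint [] = z≤n
  length-filter-disjoint (x ∷ xs) with ih ← length-filter-disjoint xs | P? x | Q? x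
  ... | yes p | yes q = ⊥-elim (disjoint p q)
  ... | yes _ | no _  = s≤s ih
  ... | no _  | yes _ = ≤-trans (≤-reflexive (+-suc _ _)) (s≤s ih)
  ... | no _  | no _  = m≤n⇒m≤1+n ih

module _ {A : Set} (f : A → ℕ) where

  upper-bound : ∀ xs → ∃[ b ] (∀ {x} → x ∈ xs → f x ≤ b)
  upper-bound [] = 0 , λ ()
  upper-bound (x ∷ xs) = let b , h = upper-bound xs in f x ⊔ b , λ
    { (here refl) → m≤m⊔n (f x) b ; (there i) → ≤-trans (h i) (m≤n⊔m (f x) b) }

  -- p is raised from 0 as long as k or more values lie above it. Then fewer than k values are at
  -- most p, because there are fewer than k + k in all, so p + 1 still has few values below.
  pivot : ∀ k xs → 0 < k → length xs < k + k →
          ∃[ p ] length (filter (λ x → f x <? p) xs) < k × length (filter (λ x → p <? f x) xs) < k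
  pivot k xs 0<k len< = go b 0
    (≤-<-trans (≤-reflexive (cong length
      (filter-none (λ x → f x <? 0) {xs = xs} (All.tabulate λ _ ())))) 0<k)
    λ {x} i → subst (f x ≤_) (sym (+-identityʳ b)) (f≤b i)
    where
    b = proj₁ (upper-bound xs)
    f≤b = proj₂ (upper-bound xs)
    go : ∀ n p → length (filter (λ x → f x <? p) xs) < k → (∀ {x} → x ∈ xs → f x ≤ n + p) →
         ∃[ p ] length (filter (λ x → f x <? p) xs) < k × length (filter (λ x → p <? f x) xs) < k
    go zero p below h = p , below ,
      ≤-<-trans (≤-reflexive (cong length
        (filter-none (λ x → p <? f x) (All.tabulate λ i → ≤⇒≯ (h i))))) 0<k
    go (suc n) p below h with length (filter (λ x → p <? f x) xs) <? k
    ... | yes above = p , below , above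
    ... | no ¬above = go n (suc p)
      (+-cancelʳ-< k _ k (≤-<-trans (+-monoʳ-≤ _ (≮⇒≥ ¬above))
        (≤-<-trans (length-filter-disjoint (λ x → f x <? suc p) (λ x → p <? f x)
           (λ fx<1+p p<fx → <⇒≱ p<fx (≤-pred fx<1+p)) xs) len<)))
      (λ i → ≤-trans (h i) (≤-reflexive (sym (+-suc n p))))

-- A bad colour above d would ask for a strict descent at depth 0, where `descends` returns the
-- verdict on equality, false; hence the condition on c.
Embeds : (ℕ → Bool) → ∀ {d m} → List (Vec ℕ d) → (Vec ℕ d → Code m) → Set
Embeds bad {d} vs code = ∀ {c xs ys} → 1 ≤ c → (bad c ≡ true → c ≤ d) → xs ∈ vs → ys ∈ vs →
  Progress bad c xs ys → T (descends (not (bad c)) (depth bad c d) (code xs) (code ys))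

module _ (bad : ℕ → Bool) where

  descends-good : ∀ {m c j} (x y : Code m) → bad c ≡ false → j ≡ 0 → T (descends (not (bad c)) j x y)
  descends-good _ _ b refl rewrite b = tt

  private
    true≢false : ∀ {b} → b ≡ true → b ≡ false → ⊥
    true≢false refl ()

    bad≤ : ∀ {c d} → (bad c ≡ true → c ≤ suc d) → bad (suc d) ≡ false → bad c ≡ true → c ≤ d
    bad≤ h good b = ≤-pred (≤∧≢⇒< (h b) λ { refl → true≢false b good })

    no-increase : ∀ {c d x y} {xs ys : Vec ℕ d} → bad (suc d) ≡ true →
                  Progress bad c (x ∷ xs) (y ∷ ys) → ¬ x < y
    no-increase b (reach g _)  = ⊥-elim (true≢false b g)
    no-increase b (skip g _)   = ⊥-elim (true≢false b g)
    no-increase b (drop _ y<x) = <-asym y<x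
    no-increase b (keep _ _ _) = <-irrefl refl

    good-above : ∀ {c d} → (bad c ≡ true → c ≤ d) → d < c → bad c ≡ false
    good-above {c} h d<c with bad c
    ... | false = refl
    ... | true  = ⊥-elim (<⇒≱ d<c (h refl))

  module _ {d m : ℕ} where

    embed-good : bad (suc d) ≡ false → (vs : List (Vec ℕ (suc d))) →
                 (code : Vec ℕ d → Code m) → Embeds bad (mapˡ tail vs) code →
                 Embeds bad vs (code ∘ tail)
    embed-good good vs code emb {c} {x ∷ xs} {y ∷ ys} 1≤c c≤ i j (reach _ d<c) =
      descends-good (code xs) (code ys) (good-c (<-cmp c (suc d)))
        (trans (depth-good bad c good) (depth-above bad d<c))
      where
      good-c : Tri (c < suc d) (c ≡ suc d) (suc d < c) → bad c ≡ false
      good-c (tri< c<1+d _ _) = ⊥-elim (<⇒≱ d<c (≤-pred c<1+d))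
      good-c (tri≈ _ refl _)  = good
      good-c (tri> _ _ 1+d<c) = good-above c≤ 1+d<c
    embed-good good vs code emb {c} {x ∷ xs} {y ∷ ys} 1≤c c≤ i j (skip _ pr) =
      subst (λ k → T (descends (not (bad c)) k (code xs) (code ys))) (sym (depth-good bad c good))
        (emb 1≤c (bad≤ c≤ good) (∈-map⁺ tail i) (∈-map⁺ tail j) pr)
    embed-good good vs code emb {c} {x ∷ xs} {y ∷ ys} 1≤c c≤ i j (drop b _) = ⊥-elim (true≢false b good)
    embed-good good vs code emb {c} {x ∷ xs} {y ∷ ys} 1≤c c≤ i j (keep b _ _) = ⊥-elim (true≢false b good)

    module _ (p : ℕ) (below above : Vec ℕ (suc d) → Code m) (at : Vec ℕ d → Code m) where

      place : ∀ {x} → Tri (x < p) (x ≡ p) (p < x) → Vec ℕ d → Code (suc m)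
      place {x} (tri< _ _ _) xs = lo ∷ below (x ∷ xs)
      place     (tri≈ _ _ _) xs = mid ∷ at xs
      place {x} (tri> _ _ _) xs = hi ∷ above (x ∷ xs)

      combine : Vec ℕ (suc d) → Code (suc m)
      combine (x ∷ xs) = place (<-cmp x p) xs

      embed-bad : bad (suc d) ≡ true → (vs : List (Vec ℕ (suc d))) →
                  Embeds bad (filter (λ xs → head xs <? p) vs) below →
                  Embeds bad (mapˡ tail vs) at →
                  Embeds bad (filter (λ xs → p <? head xs) vs) above →
                  Embeds bad vs combine
      embed-bad b vs emb< emb≈ emb> {c} {x ∷ xs} {y ∷ ys} 1≤c c≤ i j pr =
        by-level (<-cmp c (suc d))
        where
        Goal : ℕ → Set
        Goal k = T (descends (not (bad c)) k (combine (x ∷ xs)) (combine (y ∷ ys)))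

        -- With the depth in the form `suc`, `descends` computes on the first digits.
        deeper : c ≤ suc d → Progress bad c (x ∷ xs) (y ∷ ys) → Goal (suc (depth bad c d))
        deeper c≤1+d pr with <-cmp x p | <-cmp y p
        ... | tri< x<p _ _ | tri< y<p _ _ =
              subst (λ k → T (descends _ k (below (x ∷ xs)) (below (y ∷ ys)))) (depth-bad bad b c≤1+d)
                (emb< 1≤c c≤ (∈-filter⁺ _ i x<p) (∈-filter⁺ _ j y<p) pr)
        ... | tri> _ _ p<x | tri> _ _ p<y =
              subst (λ k → T (descends _ k (above (x ∷ xs)) (above (y ∷ ys)))) (depth-bad bad b c≤1+d)
                (emb> 1≤c c≤ (∈-filter⁺ _ i p<x) (∈-filter⁺ _ j p<y) pr)
        ... | tri≈ _ _ _ | tri< _ _ _ = tt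
        ... | tri> _ _ _ | tri< _ _ _ = tt
        ... | tri> _ _ _ | tri≈ _ _ _ = tt
        ... | tri≈ _ refl _ | tri≈ _ refl _ with pr
        ...   | reach g _   = ⊥-elim (true≢false b g)
        ...   | skip g _    = ⊥-elim (true≢false b g)
        ...   | drop _ x<x  = ⊥-elim (<-irrefl refl x<x)
        ...   | keep _ c≤d q = emb≈ 1≤c (λ _ → c≤d) (∈-map⁺ tail i) (∈-map⁺ tail j) q
        deeper c≤1+d pr | tri< x<p _ _ | tri≈ _ refl _ = ⊥-elim (no-increase b pr x<p)
        deeper c≤1+d pr | tri< x<p _ _ | tri> _ _ p<y  = ⊥-elim (no-increase b pr (<-trans x<p p<y))
        deeper c≤1+d pr | tri≈ _ refl _ | tri> _ _ p<y = ⊥-elim (no-increase b pr p<y)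

        by-level : Tri (c < suc d) (c ≡ suc d) (suc d < c) → Goal (depth bad c (suc d))
        by-level (tri> _ _ 1+d<c) =
          descends-good (combine (x ∷ xs)) (combine (y ∷ ys)) (good-above c≤ 1+d<c) (depth-above bad 1+d<c)
        by-level (tri< c<1+d _ _) =
          subst Goal (sym (depth-bad bad b (<⇒≤ c<1+d))) (deeper (<⇒≤ c<1+d) pr)
        by-level (tri≈ _ eq _) =
          subst Goal (sym (depth-bad bad b (≤-reflexive eq))) (deeper (≤-reflexive eq) pr)

  embed : ∀ d l {m} → tally bad d + l ≤ m → (vs : List (Vec ℕ d)) → length vs < 2 ^ l →
          ∃ (Embeds bad {d} {m} vs)
  embed-level : ∀ d l {m} → bad (suc d) ≡ true → suc (tally bad d) + l ≤ m →
                (vs : List (Vec ℕ (suc d))) → length vs < 2 ^ l → ∃ (Embeds bad {suc d} {m} vs)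

  embed zero l {m} _ vs _ = const zeros , λ 1≤c c≤ _ _ _ →
    descends-good zeros zeros (good-above c≤ 1≤c) refl
    where zeros = replicate m lo
  embed (suc d) l {m} le vs len = by-bad (bad (suc d)) refl
    where
    le′ : ∀ {b} → bad (suc d) ≡ b → bit b + tally bad d + l ≤ m
    le′ eq = subst (λ k → k + l ≤ m) (trans (tally-suc bad d) (cong (λ b → bit b + _) eq)) le

    by-bad : ∀ b → bad (suc d) ≡ b → ∃ (Embeds bad {suc d} {m} vs)
    by-bad true  eq = embed-level d l eq (le′ eq) vs len
    by-bad false eq =
      let code , emb = embed d l (le′ eq) (mapˡ tail vs)
                         (subst (_< 2 ^ l) (sym (length-map tail vs)) len)
      in code ∘ tail , embed-good eq vs code emb

  embed-level d zero b le [] len = const (replicate _ lo) , λ _ _ ()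
  embed-level d zero b le (_ ∷ _) (s≤s ())
  embed-level d (suc l) b (s≤s le) vs len =
    let k = 2 ^ l
        p , below , above = pivot head k vs (m^n>0 2 l)
                              (subst (λ n → length vs < k + n) (+-identityʳ k) len)
        le′ = ≤-trans (≤-reflexive (sym (+-suc _ l))) le
        c< , emb< = embed-level d l b le′ _ below
        c≈ , emb≈ = embed d (suc l) le (mapˡ tail vs)
                      (subst (_< 2 ^ suc l) (sym (length-map tail vs)) len)
        c> , emb> = embed-level d l b le′ _ above
    in combine p c< c> c≈ , embed-bad p c< c> c≈ b vs emb< emb≈ emb>

-- Winning regions

module _ {f : ℕ → ℕ} where

  -- Induction on the bound: if `suc D` is not reached beyond some index, then D bounds a tail.
  limsup-exists : ∀ D m → (∀ i → m ≤ i → f i ≤ D) → ¬ ¬ ∃ (IsLimSup f)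
  limsup-exists D m f≤D none = none (D , (m , f≤D) , λ m′ rare → lower D f≤D m′ rare)
    where
    lower : ∀ D → (∀ i → m ≤ i → f i ≤ D) → ∀ m′ → ¬ ¬ (∃[ i ] m′ ≤ i × D ≤ f i)
    lower zero _ m′ rare = rare (m′ , ≤-refl , z≤n)
    lower (suc D) f≤ m′ rare = limsup-exists D (m ⊔ m′)
      (λ i m≤i → ≮⇒≥ λ D<fi → rare (i , ≤-trans (m≤n⊔m m m′) m≤i , D<fi)) none

  module _ {c : ℕ} (limsup : IsLimSup f c) where

    private
      m = proj₁ (proj₁ limsup)
      f≤c = proj₂ (proj₁ limsup)

    limsup-attained : ¬ ¬ (∃[ i ] f i ≡ c)
    limsup-attained never = proj₂ limsup m λ (i , m≤i , c≤fi) →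
      never (i , ≤-antisym (f≤c i m≤i) c≤fi)

    -- From the index m on, u never increases, and it drops whenever the limsup is attained, which
    -- cannot fail to happen again.
    limsup-no-descent : (u : ℕ → ℕ) → (∀ i → f i ≤ c → u (suc i) ≤ u i) →
                        (∀ i → f i ≡ c → u (suc i) < u i) → ⊥
    limsup-no-descent u weak strict = below _ m ≤-refl ≤-refl
      where
      weak* : ∀ {i j} → m ≤ i → i ≤′ j → u j ≤ u i
      weak* m≤i ≤′-refl = ≤-refl
      weak* m≤i (≤′-step {j} i≤j) =
        ≤-trans (weak j (f≤c j (≤-trans m≤i (≤′⇒≤ i≤j)))) (weak* m≤i i≤j)
      below : ∀ k i → m ≤ i → u i < k → ⊥
      below (suc k) i m≤i (s≤s ui≤k) = proj₂ limsup i λ (j , i≤j , c≤fj) →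
        let m≤j = ≤-trans m≤i i≤j in
        below k (suc j) (m≤n⇒m≤1+n m≤j)
          (<-≤-trans (strict j (≤-antisym (f≤c j m≤j) c≤fj))
                     (≤-trans (weak* m≤i (≤⇒≤′ i≤j)) ui≤k))

isEven : ℕ → Bool
isEven c = does (2 ∣? c)

n<2^n : ∀ n → n < 2 ^ n
n<2^n zero = s≤s z≤n
n<2^n (suc n) = ≤-trans (s≤s (n<2^n n)) (≤-trans (+-monoˡ-≤ (2 ^ n) (m^n>0 2 n))
  (≤-reflexive (cong (2 ^ n +_) (sym (+-identityʳ (2 ^ n))))))

anyᵇ : {A : Set} → (A → Bool) → List A → Bool
anyᵇ p = foldr (λ x b → p x ∨ b) false

module _ {A : Set} {p : A → Bool} where

  anyᵇ⁺ : ∀ {x xs} → x ∈ xs → T (p x) → T (anyᵇ p xs)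
  anyᵇ⁺ (here refl) t = Equivalence.from T-∨ (inj₁ t)
  anyᵇ⁺ (there i)   t = Equivalence.from T-∨ (inj₂ (anyᵇ⁺ i t))

  anyᵇ⁻ : ∀ xs → T (anyᵇ p xs) → ∃[ x ] x ∈ xs × T (p x)
  anyᵇ⁻ (x ∷ xs) t with Equivalence.to T-∨ t
  ... | inj₁ u = x , here refl , u
  ... | inj₂ u = let y , i , v = anyᵇ⁻ xs u in y , there i , v

not⁺ : ∀ {b} → ¬ T b → T (not b)
not⁺ {true}  ¬t = ¬t tt
not⁺ {false} ¬t = tt

not⁻ : ∀ {b} → T (not b) → ¬ T b
not⁻ {false} _ ()

-- With one negation inside and one outside for even, the same existential search over successors
-- also decides the universal condition at her vertices.
agree : Player → Bool → Bool
agree even b = not b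
agree odd  b = b

filterᵇ-∧ : {A : Set} (p q : A → Bool) → ∀ xs →
            filterᵇ q (filterᵇ p xs) ≡ filterᵇ (λ x → p x ∧ q x) xs
filterᵇ-∧ p q [] = refl
filterᵇ-∧ p q (x ∷ xs) with p x
... | false = filterᵇ-∧ p q xs
... | true with q x
...   | false = filterᵇ-∧ p q xs
...   | true  = cong (x ∷_) (filterᵇ-∧ p q xs)

module _ {A : Set} {f g : A → ℕ} (f≤g : ∀ x → f x ≤ g x) where

  sum-mono : ∀ xs → sum (mapˡ f xs) ≤ sum (mapˡ g xs)
  sum-mono []       = z≤n
  sum-mono (x ∷ xs) = +-mono-≤ (f≤g x) (sum-mono xs)

  sum-strict : ∀ {x xs} → x ∈ xs → f x < g x → sum (mapˡ f xs) < sum (mapˡ g xs)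
  sum-strict {xs = _ ∷ xs} (here refl) lt = +-mono-<-≤ lt (sum-mono xs)
  sum-strict {xs = x ∷ _}  (there i) lt   = +-mono-≤-< (f≤g x) (sum-strict i lt)

iterate : {A : Set} → (A → A) → ℕ → A → A
iterate f zero    x = x
iterate f (suc k) x = iterate f k (f x)

module Game (G : ParityGame) where
  open ParityGame G
  open Determinacy G

  used : ℕ → Bool
  used c = does (any? (λ v → φ v ≟ⁿ c))

  used-φ : ∀ v → used (φ v) ≡ true
  used-φ v = dec-true (any? _) (v , refl)

  -- The colours that must not be the limsup of a play won by the player.
  -- Unused even colours are left out, so that the measures of odd have no more
  -- levels than there are even vertices.
  bad : Player → ℕ → Bool
  bad even c = not (isEven c)
  bad odd  c = isEven c ∧ used c

  exclusive : ∀ p i → bad p i ≡ true → bad (opponent p) i ≡ false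
  exclusive even i b with isEven i
  ... | false = refl
  exclusive odd i b with isEven i
  ... | true = refl

  covering : ∀ v → ∃[ p ] bad p (φ v) ≡ true
  covering v with isEven (φ v) in eq
  ... | true  = odd , cong₂ _∧_ eq (used-φ v)
  ... | false = even , cong not eq

  positive : ∀ v → 1 ≤ φ v
  positive v = All.lookup C-positive (φ∈C v)

  maxColour : ℕ
  maxColour = proj₁ (upper-bound id C)

  C≤max : ∀ {c} → c ∈ C → c ≤ maxColour
  C≤max = proj₂ (upper-bound id C)

  All-V : V → Set
  All-V _ = ⊤

  solution : Solution bad exclusive covering positive maxColour All-V
  solution = zielonka bad exclusive covering positive maxColour (λ _ → yes tt)
    (λ v _ → let w , e = total v in w , e , tt) (λ {v} _ → C≤max (φ∈C v))

  open Solution solution public using (W)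
  private module S = Solution solution

  Descends : ∀ {m} → Player → V → Code m → Code m → Set
  Descends p v x y = T (descends (not (bad p (φ v))) (depth (bad p) (φ v) maxColour) x y)

  levels : Player → ℕ
  levels p = tally (bad p) maxColour

  -- A measure after its embedding. The length is a parameter because odd needs short codes for the
  -- program, while any length serves to show that a strategy wins.
  record Certificate (p : Player) (m : ℕ) : Set where
    field
      code : V → Code m
      win  : ∀ {v} → W v ≡ p →
             Forces p All-V (λ w → W w ≡ p × Descends p v (code v) (code w)) v

  certificate : ∀ p l → n < 2 ^ l → Certificate p (levels p + l)
  certificate p l n<2^l = record
    { code = proj₁ emb ∘ S.μ p
    ; win  = λ {v} eq → forces-map (λ w _ _ (eq′ , pr) → eq′ ,
               proj₂ emb (positive v) (λ _ → C≤max (φ∈C v)) (measures v) (measures w) pr)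
               (S.win p tt eq) }
    where
    vs : List (Vec ℕ maxColour)
    vs = mapˡ (S.μ p) (allFin n)
    emb = embed (bad p) maxColour l ≤-refl vs
            (subst (_< 2 ^ l)
              (sym (trans (length-map (S.μ p) (allFin n)) (length-tabulate {n = n} id))) n<2^l)
    measures : ∀ v → S.μ p v ∈ vs
    measures v = ∈-map⁺ (S.μ p) (∈-allFin v)

  good-limsup⇒won : ∀ p (ρ : ℕ → V) →
    (∀ c → bad p c ≡ true → ¬ IsLimSup (φ ∘ ρ) c) → WonBy G p ρ
  good-limsup⇒won even ρ good ¬E =
    limsup-exists maxColour 0 (λ i _ → C≤max (φ∈C (ρ i))) λ (c , limsup) → by-parity c limsup (2 ∣? c)
    where
    by-parity : ∀ c → IsLimSup (φ ∘ ρ) c → Dec (2 ∣ c) → ⊥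
    by-parity c limsup (yes 2∣c) = ¬E (c , limsup , 2∣c)
    by-parity c limsup (no 2∤c)  = good c (cong not (dec-false (2 ∣? c) 2∤c)) limsup
  good-limsup⇒won odd ρ good (c , limsup , 2∣c) = limsup-attained limsup λ (i , eq) →
    good c (cong₂ _∧_ (dec-true (2 ∣? c) 2∣c) (dec-true (any? _) (ρ i , eq))) limsup

  descends⇒won : ∀ p {m} (ρ : ℕ → V) (x : ℕ → Code m) →
    (∀ i → Descends p (ρ i) (x i) (x (suc i))) → WonBy G p ρ
  descends⇒won p ρ x desc = good-limsup⇒won p ρ λ c bad-c limsup →
    let j = depth (bad p) c maxColour in
    limsup-no-descent limsup (value j ∘ x)
      (λ i φ≤c → descends⇒≤ (x i) (x (suc i)) (depth-anti (bad p) maxColour φ≤c) (desc i))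
      (λ { i refl → descends⇒< j (x i) (x (suc i))
                      (subst (λ r → T (descends (not r) j (x i) (x (suc i)))) bad-c (desc i)) })

  module _ {p m} (cert : Certificate p m) where
    open Certificate cert

    private
      move : ∀ v → owner v ≡ p → Dec (W v ≡ p) → ∃[ w ] Edge v w
      -- Consistent plays from the region never come here; any edge completes the strategy.
      move v o (no _) = total v
      move v o (yes eq) with win eq
      ... | own _ (w , e , _) = w , e
      ... | other o′ _        = ⊥-elim (opponent≢ p (trans (sym o′) o))

      move-wins : ∀ v o (d : Dec (W v ≡ p)) → W v ≡ p →
                  let w = proj₁ (move v o d) in W w ≡ p × Descends p v (code v) (code w)
      move-wins v o (no ¬eq) eq = ⊥-elim (¬eq eq)
      move-wins v o (yes eq) _ with win eq
      ... | own _ (w , _ , _ , q) = q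
      ... | other o′ _            = ⊥-elim (opponent≢ p (trans (sym o′) o))

    certificate⇒wins : ∀ v → W v ≡ p → WinsFrom G p v
    certificate⇒wins v Wv = (λ _ u o → move u o (W u ≟ p)) , λ ρ play start consistent →
      let won i Wi = step ρ play consistent i Wi (owner (ρ i) ≟ p)
      in descends⇒won p ρ (code ∘ ρ) λ i →
           proj₂ (won i (stays ρ won (trans (cong W start) Wv) i))
      where
      Next : V → V → Set
      Next u w = W w ≡ p × Descends p u (code u) (code w)
      step : ∀ ρ → IsPlay G ρ → Consistent G {p} (λ _ u o → move u o (W u ≟ p)) ρ →
             ∀ i → W (ρ i) ≡ p → Dec (owner (ρ i) ≡ p) → Next (ρ i) (ρ (suc i))
      step ρ play consistent i Wi (yes o) =
        subst (Next (ρ i)) (sym (consistent i o)) (move-wins (ρ i) o (W (ρ i) ≟ p) Wi)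
      step ρ play consistent i Wi (no ¬o) = forces-all (win Wi) (≢⇒opponent ¬o) (play i) tt
      stays : ∀ ρ → (∀ i → W (ρ i) ≡ p → Next (ρ i) (ρ (suc i))) → W (ρ 0) ≡ p → ∀ i → W (ρ i) ≡ p
      stays ρ won W₀ zero = W₀
      stays ρ won W₀ (suc i) = proj₁ (won i (stays ρ won W₀ i))

  W-isSolution : IsSolution G W
  -- Only existence counts here, so l = n is affordable.
  W-isSolution v = certificate⇒wins (certificate (W v) n (n<2^n n)) v refl

  evenColours : List ℕ
  evenColours = filterᵇ (bad odd) C

  rank : V → ℕ
  rank v = length (filterᵇ (φ v ≤ᵇ_) evenColours)

  bad-odd⇒ : ∀ {c} → T (bad odd c) → ∃[ v ] φ v ≡ c
  bad-odd⇒ {c} t with any? (λ v → φ v ≟ⁿ c) | Equivalence.to (T-∧ {isEven c}) t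
  ... | yes x | _ = x

  private
    sat : ∀ c → T (bad odd c) → c ∈ C × 1 ≤ c × c ≤ maxColour
    sat c t with bad-odd⇒ {c} t
    ... | v , refl = φ∈C v , positive v , C≤max (φ∈C v)

  levels-odd : levels odd ≡ length evenColours
  levels-odd = tally-unique (bad odd) maxColour C-unique sat

  depth-odd : ∀ v → depth (bad odd) (φ v) maxColour ≡ rank v
  depth-odd v = trans
    (tally-unique _ maxColour C-unique λ c t → sat c (proj₁ (Equivalence.to T-∧ t)))
    (cong length (sym (filterᵇ-∧ (bad odd) (φ v ≤ᵇ_) C)))

  bad-odd-φ : ∀ v → bad odd (φ v) ≡ isEven (φ v)
  bad-odd-φ v = trans (cong (isEven (φ v) ∧_) (used-φ v)) (∧-identityʳ _)

  module Fixpoint (m : ℕ) where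

    Alive : Set
    Alive = V → List (Code m)

    descendsAt : V → Code m → Code m → Bool
    descendsAt v = descends (not (isEven (φ v))) (rank v)

    Descends≡ : ∀ v x y → Descends odd v x y ≡ T (descendsAt v x y)
    Descends≡ v x y = cong₂ (λ b j → T (descends (not b) j x y)) (bad-odd-φ v) (depth-odd v)

    supports : Alive → V → Code m → V → Bool
    supports A v x w = edge v w ∧ agree (owner v) (anyᵇ (descendsAt v x) (A w))

    keeps : Alive → V → Code m → Bool
    keeps A v x = agree (owner v) (anyᵇ (supports A v x) (allFin n))

    Supported : Alive → V → Code m → V → Set
    Supported A v x w = ∃[ y ] y ∈ A w × T (descendsAt v x y)

    keeps⁺ : ∀ {A v x} → Forces odd All-V (Supported A v x) v → T (keeps A v x)
    keeps⁺ {A} {v} {x} (own o (w , e , _ , y , y∈ , t)) rewrite o =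
      anyᵇ⁺ (∈-allFin w) (Equivalence.from T-∧ (e , anyᵇ⁺ y∈ t))
    keeps⁺ {A} {v} {x} (other o f) rewrite o = not⁺ (λ t →
      let w , _ , u = anyᵇ⁻ (allFin n) t
          e , none  = Equivalence.to T-∧ u
          y , y∈ , d = f w e tt
      in not⁻ none (anyᵇ⁺ y∈ d))

    keeps⁻ : ∀ {A v x} → T (keeps A v x) → Forces odd All-V (Supported A v x) v
    keeps⁻ {A} {v} {x} t with owner v in o
    ... | odd = let w , _ , u = anyᵇ⁻ (allFin n) t
                    e , a     = Equivalence.to T-∧ u
                in own o (w , e , tt , anyᵇ⁻ (A w) a)
    ... | even = other o λ w e _ → anyᵇ⁻ (A w) (decidable-stable (T? _) λ ¬a →
                   not⁻ t
                     (anyᵇ⁺ (∈-allFin w) (Equivalence.from T-∧ (e , not⁺ ¬a))))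

    step : Alive → Alive
    step A v = filterᵇ (keeps A v) (A v)

    Fixed : Alive → Set
    Fixed A = ∀ v {x} → x ∈ A v → T (keeps A v x)

    fixed-step : ∀ {A} → Fixed A → Fixed (step A)
    fixed-step {A} stable v x∈ = keeps⁺ (forces-map
      (λ w _ _ (y , y∈ , t) → y , subst (y ∈_) (sym (same w)) y∈ , t)
      (keeps⁻ (stable v (subst (_ ∈_) (same v) x∈))))
      where
      same : ∀ w → step A w ≡ A w
      same w = filter-all (T? ∘ keeps A w) (All.tabulate (stable w))

    -- The program does not test for stability but runs a fixed number of rounds, so the surplus
    -- rounds must do no harm.
    fixed-iterate : ∀ k {A} → Fixed A → Fixed (iterate step k A)
    fixed-iterate zero    stable = stable
    fixed-iterate (suc k) stable = fixed-iterate k (fixed-step stable)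

    population : Alive → ℕ
    population A = sum (mapˡ (length ∘ A) (allFin n))

    -- Steps only remove codes, so either the population drops, which can happen at most k times, or
    -- nothing was removed and A is already stable.
    iterate-fixed : ∀ k A → population A ≤ k → Fixed (iterate step k A)
    iterate-fixed k A ≤k with population (step A) <? population A
    ... | no ¬lt = fixed-iterate k λ v {x} x∈ → decidable-stable (T? _) λ ¬t →
            ¬lt (sum-strict (λ w → length-filter (T? ∘ keeps A w) (A w)) (∈-allFin v)
              (filter-notAll (T? ∘ keeps A v) (A v) (lose x∈ ¬t)))
    iterate-fixed zero A ≤k | yes lt = ⊥-elim (n≮0 (<-≤-trans lt ≤k))
    iterate-fixed (suc k) A ≤k | yes lt =
      iterate-fixed k (step A) (≤-pred (≤-trans lt ≤k))

    module _ (cert : Certificate odd m) where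
      open Certificate cert

      code-survives : ∀ k {A} → (∀ v → W v ≡ odd → code v ∈ A v) →
                      ∀ v → W v ≡ odd → code v ∈ iterate step k A v
      code-survives zero    h = h
      code-survives (suc k) {A} h = code-survives k λ v eq → ∈-filter⁺ (T? ∘ keeps A v) (h v eq)
        (keeps⁺ (forces-map (λ w _ _ (eq′ , d) →
           code w , h w eq′ , subst id (Descends≡ v (code v) (code w)) d) (win eq)))

    -- A code alive on the winning region of even would allow a play on which
    -- the measures of both players descend, so that both players would win it.
    fixed-dead : ∀ {A} → Fixed A → ∀ v → W v ≡ even → ∀ {x} → ¬ x ∈ A v
    fixed-dead {A} stable v Wv {x} x∈ =
      descends⇒won even vertex (code ∘ vertex) (λ i → proj₁ (descent i))
        (descends⇒won odd vertex odd-code (λ i →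
          subst id (sym (Descends≡ (vertex i) (odd-code i) (odd-code (suc i)))) (proj₂ (descent i))))
      where
      open Certificate (certificate even n (n<2^n n))

      State : Set
      State = ∃[ u ] W u ≡ even × ∃[ y ] y ∈ A u

      Next : State → State → Set
      Next (u , _ , y , _) (w , _ , z , _) = Descends even u (code u) (code w) × T (descendsAt u y z)

      next : ∀ s → ∃ (Next s)
      -- The owner of u picks the move, and the condition of the other player holds for all moves,
      -- so one successor satisfies both.
      next (u , Wu , y , y∈) with win Wu | keeps⁻ {A} (stable u y∈)
      ... | own o (w , e , _ , Ww , d) | f =
            let z , z∈ , d′ = forces-all f o e tt in (w , Ww , z , z∈) , d , d′
      ... | other o f | own _ (w , e , _ , z , z∈ , d′) =
            let Ww , d = f w e tt in (w , Ww , z , z∈) , d , d′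
      ... | other o f | other o′ _ with () ← trans (sym o) o′

      state : ℕ → State
      state zero    = v , Wv , x , x∈
      state (suc i) = proj₁ (next (state i))

      vertex : ℕ → V
      vertex i = proj₁ (state i)

      odd-code : ℕ → Code m
      odd-code i = proj₁ (proj₂ (proj₂ (state i)))

      descent : ∀ i → Next (state i) (state (suc i))
      descent i = proj₂ (next (state i))

    winner : List (Code m) → Player
    winner []      = even
    winner (_ ∷ _) = odd

    winner-correct : ∀ {A} → Fixed A → (∀ v → W v ≡ odd → ∃[ x ] x ∈ A v) →
                     ∀ v → winner (A v) ≡ W v
    winner-correct {A} stable alive v with W v in eq
    ... | even with A v in eqA
    ...   | []    = refl
    ...   | x ∷ _ = ⊥-elim (fixed-dead stable v eq (subst (x ∈_) (sym eqA) (here refl)))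
    winner-correct {A} stable alive v | odd with A v | alive v eq
    ... | _ ∷ _ | _ = refl

-- A loop language for programs

private variable
  m ν : ℕ
  A B : Set


-- An expression language with de Bruijn variables.  In fold xs z b the body b
-- sees the current element as variable 0 and the accumulator as variable 1.
-- In call f σ the term f sees only the variables listed in σ.
data Term : ℕ → Set where
  var   : Fin ν → Term ν
  nil   : Term ν
  cons  : Term ν → Term ν → Term ν
  hd tl : Term ν → Term ν
  ite   : Term ν → Term ν → Term ν → Term ν
  bind  : Term ν → Term (suc ν) → Term ν
  fold  : Term ν → Term ν → Term (2 + ν) → Term ν
  call  : Term m → Vec (Fin ν) m → Term ν

-- Evaluation is a relation so that a derivation also bounds the rounds of every
-- loop by N, which is all that the running time depends on.
module Evaluation (N : ℕ) where

  infix 4 _⊢_⇓_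

  data _⊢_⇓_ : Vec Tree ν → Term ν → Tree → Set

  data Loop (Γ : Vec Tree ν) (b : Term (2 + ν)) : Tree → Tree → ℕ → Tree → Set where
    done : ∀ {a} → Loop Γ b nil a 0 a
    next : ∀ {x xs a a′ r k} → (x ∷ a ∷ Γ) ⊢ b ⇓ a′ → Loop Γ b xs a′ k r →
           Loop Γ b (x ∙ xs) a (suc k) r

  data _⊢_⇓_ where
    var       : ∀ {Γ : Vec Tree ν} i → Γ ⊢ var i ⇓ lookup Γ i
    nil       : ∀ {Γ : Vec Tree ν} → Γ ⊢ nil ⇓ nil
    cons      : ∀ {Γ : Vec Tree ν} {t u x y} → Γ ⊢ t ⇓ x → Γ ⊢ u ⇓ y → Γ ⊢ cons t u ⇓ x ∙ y
    hd        : ∀ {Γ : Vec Tree ν} {t x} → Γ ⊢ t ⇓ x → Γ ⊢ hd t ⇓ left x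
    tl        : ∀ {Γ : Vec Tree ν} {t x} → Γ ⊢ t ⇓ x → Γ ⊢ tl t ⇓ right x
    ite-true  : ∀ {Γ : Vec Tree ν} {t u v x y z} →
                Γ ⊢ t ⇓ x ∙ y → Γ ⊢ u ⇓ z → Γ ⊢ ite t u v ⇓ z
    ite-false : ∀ {Γ : Vec Tree ν} {t u v z} →
                Γ ⊢ t ⇓ nil → Γ ⊢ v ⇓ z → Γ ⊢ ite t u v ⇓ z
    bind      : ∀ {Γ : Vec Tree ν} {t u x y} → Γ ⊢ t ⇓ x → (x ∷ Γ) ⊢ u ⇓ y → Γ ⊢ bind t u ⇓ y
    fold      : ∀ {Γ : Vec Tree ν} {t u b xs z r k} → Γ ⊢ t ⇓ xs → Γ ⊢ u ⇓ z →
                Loop Γ b xs z k r → k ≤ N → Γ ⊢ fold t u b ⇓ r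
    call      : ∀ {Γ : Vec Tree ν} {f : Term m} {σ x} → map (lookup Γ) σ ⊢ f ⇓ x →
                Γ ⊢ call f σ ⇓ x

-- The compiler.  The only program variable holds a stack; the code of a term
-- pushes its value.  ρ gives the stack positions of the variables.

popped : ℕ → Tree → Tree
popped zero    s = s
popped (suc k) s = popped k (right s)

tls : ℕ → Expr 1 → Expr 1
tls zero    e = e
tls (suc k) e = tls k (tl e)

at : ℕ → Expr 1
at k = hd (tls k (var zero))

above : ℕ → Expr 1
above k = tls k (var zero)

⟦tls⟧ : ∀ k e s → ⟦ tls k e ⟧ s ≡ popped k (⟦ e ⟧ s)
⟦tls⟧ zero    e s = refl
⟦tls⟧ (suc k) e s = ⟦tls⟧ k (tl e) s

set : Expr 1 → Cmd 1
set e = zero ≔ e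

bound : (Fin ν → ℕ) → Fin (suc ν) → ℕ
bound ρ zero    = 0
bound ρ (suc i) = suc (ρ i)

-- Position 2 holds the list being traversed, which the body cannot name; hence the offset 3.
inLoop : (Fin ν → ℕ) → Fin (2 + ν) → ℕ
inLoop ρ zero          = 0
inLoop ρ (suc zero)    = 1
inLoop ρ (suc (suc i)) = 3 + ρ i

-- While the loop runs the stack holds the accumulator and the remaining list.
module _ (body : Cmd 1) where

  round : Cmd 1
  round = set (cons (hd (at 1)) (var zero)) ⨾
          body ⨾
          -- After the body the stack holds the new accumulator, the element, the old accumulator,
          -- the list, and what was below the loop.
          set (cons (at 0) (cons (tl (at 3)) (above 4)))

  loop : Cmd 1
  loop = while at 1 loop round

compile : (Fin ν → ℕ) → Term ν → Cmd 1
compile ρ (var i)      = set (cons (at (ρ i)) (var zero))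
compile ρ nil          = set (cons nil (var zero))
compile ρ (cons t u)   = compile ρ t ⨾ compile (suc ∘ ρ) u ⨾ set (cons (cons (at 1) (at 0)) (above 2))
compile ρ (hd t)       = compile ρ t ⨾ set (cons (hd (at 0)) (above 1))
compile ρ (tl t)       = compile ρ t ⨾ set (cons (tl (at 0)) (above 1))
compile ρ (ite t u v)  = compile ρ t ⨾
                         if at 0 then (set (above 1) ⨾ compile ρ u)
                                 else (set (above 1) ⨾ compile ρ v)
compile ρ (bind t u)   = compile ρ t ⨾ compile (bound ρ) u ⨾ set (cons (at 0) (above 2))
compile ρ (fold t u b) = compile ρ t ⨾ compile (suc ∘ ρ) u ⨾
                         loop (compile (inLoop ρ) b) ⨾ set (cons (at 0) (above 2))
compile ρ (call f σ)   = compile (ρ ∘ lookup σ) f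

setTime : Expr 1 → ℕ
setTime e = 1 + cost e

roundTime : ℕ → ℕ
roundTime t = setTime (cons (hd (at 1)) (var zero)) +
              (t + setTime (cons (at 0) (cons (tl (at 3)) (above 4))))

loopTime : ℕ → ℕ → ℕ
loopTime k t = k * (1 + cost (at 1) + roundTime t) + (1 + cost (at 1))

-- Independent of the data: both branches of a conditional are charged and every loop is charged N
-- rounds. For a fixed term this is a polynomial in N.
time : ℕ → (Fin ν → ℕ) → Term ν → ℕ
time N ρ (var i)      = setTime (cons (at (ρ i)) (var zero))
time N ρ nil          = setTime (cons nil (var zero))
time N ρ (cons t u)   = time N ρ t + (time N (suc ∘ ρ) u + setTime (cons (cons (at 1) (at 0)) (above 2)))
time N ρ (hd t)       = time N ρ t + setTime (cons (hd (at 0)) (above 1))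
time N ρ (tl t)       = time N ρ t + setTime (cons (tl (at 0)) (above 1))
time N ρ (ite t u v)  = time N ρ t + (1 + cost (at 0) + (setTime (above 1) + (time N ρ u + time N ρ v)))
time N ρ (bind t u)   = time N ρ t + (time N (bound ρ) u + setTime (cons (at 0) (above 2)))
time N ρ (fold t u b) = time N ρ t + (time N (suc ∘ ρ) u +
                          (loopTime N (time N (inLoop ρ) b) + setTime (cons (at 0) (above 2))))
time N ρ (call f σ)   = time N (ρ ∘ lookup σ) f

Runs : Cmd 1 → Tree → Tree → ℕ → Set
Runs c s s′ b = ∃[ t ] (Exec c (s ∷ []) (s′ ∷ []) t × t ≤ b)

runs-set : ∀ e {s} → Runs (set e) s (⟦ e ⟧ (s ∷ [])) (setTime e)
runs-set e = _ , assign , ≤-refl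

runs-seq : ∀ {c d s s′ s″ a b} → Runs c s s′ a → Runs d s′ s″ b → Runs (c ⨾ d) s s″ (a + b)
runs-seq (_ , p , p≤) (_ , q , q≤) = _ , seq p q , +-mono-≤ p≤ q≤

runs-weaken : ∀ {c s s′ a b} → a ≤ b → Runs c s s′ a → Runs c s s′ b
runs-weaken a≤b (t , p , t≤a) = t , p , ≤-trans t≤a a≤b

module Correctness (N : ℕ) where
  open Evaluation N

  Stored : (Fin ν → ℕ) → Vec Tree ν → Tree → Set
  Stored ρ Γ s = ∀ i → left (popped (ρ i) s) ≡ lookup Γ i

  compile-correct : ∀ {Γ : Vec Tree ν} {t x} → Γ ⊢ t ⇓ x → ∀ ρ s → Stored ρ Γ s →
                    Runs (compile ρ t) s (x ∙ s) (time N ρ t)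

  loop-correct : ∀ {Γ : Vec Tree ν} {b xs z k r} → Loop Γ b xs z k r → ∀ ρ s → Stored ρ Γ s →
                 Runs (loop (compile (inLoop ρ) b)) (z ∙ xs ∙ s) (r ∙ nil ∙ s)
                      (loopTime k (time N (inLoop ρ) b))

  compile-correct (var i) ρ s st = subst (λ x → Runs _ s (x ∙ s) _)
    (trans (cong left (⟦tls⟧ (ρ i) (var zero) (s ∷ []))) (st i)) (runs-set (cons (at (ρ i)) (var zero)))
  compile-correct nil ρ s st = runs-set _
  compile-correct (cons d e) ρ s st =
    runs-seq (compile-correct d ρ s st) (runs-seq (compile-correct e (suc ∘ ρ) _ st) (runs-set _))
  compile-correct (hd d) ρ s st = runs-seq (compile-correct d ρ s st) (runs-set _)
  compile-correct (tl d) ρ s st = runs-seq (compile-correct d ρ s st) (runs-set _)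
  compile-correct (ite-true d e) ρ s st = runs-seq (compile-correct d ρ s st)
    (let _ , p , p≤ = runs-seq (runs-set (above 1)) (compile-correct e ρ s st) in
     _ , if-true refl p , +-monoʳ-≤ (1 + cost (at 0))
           (≤-trans p≤ (+-monoʳ-≤ (setTime (above 1)) (m≤m+n _ _))))
  compile-correct (ite-false d e) ρ s st = runs-seq (compile-correct d ρ s st)
    (let _ , p , p≤ = runs-seq (runs-set (above 1)) (compile-correct e ρ s st) in
     _ , if-false refl p , +-monoʳ-≤ (1 + cost (at 0))
           (≤-trans p≤ (+-monoʳ-≤ (setTime (above 1)) (m≤n+m _ _))))
  compile-correct (bind d e) ρ s st = runs-seq (compile-correct d ρ s st)
    (runs-seq (compile-correct e (bound ρ) _ λ { zero → refl ; (suc i) → st i }) (runs-set _))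
  compile-correct (fold {b = b} {k = k} d e l k≤N) ρ s st = runs-seq (compile-correct d ρ s st)
    (runs-seq (compile-correct e (suc ∘ ρ) _ st)
      (runs-seq (runs-weaken (+-monoˡ-≤ (1 + cost (at 1)) (*-monoˡ-≤ _ k≤N)) (loop-correct l ρ s st))
        (runs-set _)))
  compile-correct {Γ = Γ} (call {σ = σ} d) ρ s st =
    compile-correct d (ρ ∘ lookup σ) s λ i → trans (st (lookup σ i)) (sym (lookup-map i (lookup Γ) σ))

  loop-correct done ρ s st = _ , while-done refl , ≤-refl
  loop-correct {b = b} (next {x} {xs} {a} {k = k} d l) ρ s st =
    let _ , p , p≤ = runs-seq (runs-set (cons (hd (at 1)) (var zero)))
                       (runs-seq (compile-correct d (inLoop ρ) (x ∙ a ∙ (x ∙ xs) ∙ s)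
                                   λ { zero → refl ; (suc zero) → refl ; (suc (suc i)) → st i })
                                 (runs-set (cons (at 0) (cons (tl (at 3)) (above 4)))))
        _ , q , q≤ = loop-correct l ρ s st
        w = time N (inLoop ρ) b
    in _ , while-true refl p q , ≤-trans
         (+-mono-≤ (+-monoʳ-≤ (1 + cost (at 1)) p≤) q≤)
         (≤-reflexive (sym (+-assoc (1 + cost (at 1) + roundTime w)
                                    (k * (1 + cost (at 1) + roundTime w)) _)))

-- Polynomial bounds

PolynomiallyBounded : (ℕ → ℕ) → Set
PolynomiallyBounded f = ∃[ a ] ∃[ d ] (∀ x → f x ≤ a * suc x ^ d)

module _ {f g : ℕ → ℕ} (pf : PolynomiallyBounded f) (pg : PolynomiallyBounded g) where

  private
    a = proj₁ pf
    b = proj₁ pg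
    d = proj₁ (proj₂ pf)
    e = proj₁ (proj₂ pg)

  -- Both exponents may be raised to d + e because the base `suc x` is positive; with base x this
  -- would fail at 0.
  poly-+ : PolynomiallyBounded (λ x → f x + g x)
  poly-+ = a + b , d + e , λ x → begin
    f x + g x                              ≤⟨ +-mono-≤ (proj₂ (proj₂ pf) x) (proj₂ (proj₂ pg) x) ⟩
    a * suc x ^ d + b * suc x ^ e          ≤⟨ +-mono-≤ (*-monoʳ-≤ a (^-monoʳ-≤ (suc x) (m≤m+n d e)))
                                                       (*-monoʳ-≤ b (^-monoʳ-≤ (suc x) (m≤n+m e d))) ⟩
    a * suc x ^ (d + e) + b * suc x ^ (d + e) ≡⟨ *-distribʳ-+ (suc x ^ (d + e)) a b ⟨
    (a + b) * suc x ^ (d + e)              ∎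
    where open ≤-Reasoning

  poly-* : PolynomiallyBounded (λ x → f x * g x)
  poly-* = a * b , d + e , λ x → begin
    f x * g x                              ≤⟨ *-mono-≤ (proj₂ (proj₂ pf) x) (proj₂ (proj₂ pg) x) ⟩
    (a * suc x ^ d) * (b * suc x ^ e)      ≡⟨ [m*n]*[o*p]≡[m*o]*[n*p] a _ b _ ⟩
    (a * b) * (suc x ^ d * suc x ^ e)      ≡⟨ cong (a * b *_) (^-distribˡ-+-* (suc x) d e) ⟨
    (a * b) * suc x ^ (d + e)              ∎
    where open ≤-Reasoning

poly-const : ∀ c → PolynomiallyBounded (const c)
poly-const c = c , 0 , λ _ → ≤-reflexive (sym (*-identityʳ c))

poly-id : PolynomiallyBounded (λ x → x)
poly-id = 1 , 1 , λ x → ≤-trans (n≤1+n x) (≤-reflexive (sym (trans (*-identityˡ _) (*-identityʳ _))))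

poly-time : ∀ ρ (t : Term ν) → PolynomiallyBounded (λ N → time N ρ t)
poly-time ρ (var i)      = poly-const _
poly-time ρ nil          = poly-const _
poly-time ρ (cons t u)   = poly-+ (poly-time ρ t) (poly-+ (poly-time (suc ∘ ρ) u) (poly-const _))
poly-time ρ (hd t)       = poly-+ (poly-time ρ t) (poly-const _)
poly-time ρ (tl t)       = poly-+ (poly-time ρ t) (poly-const _)
poly-time ρ (ite t u v)  = poly-+ (poly-time ρ t) (poly-+ (poly-const (1 + cost (at 0)))
  (poly-+ (poly-const (setTime (above 1))) (poly-+ (poly-time ρ u) (poly-time ρ v))))
poly-time ρ (bind t u)   = poly-+ (poly-time ρ t) (poly-+ (poly-time (bound ρ) u) (poly-const _))
poly-time ρ (fold t u b) = poly-+ (poly-time ρ t) (poly-+ (poly-time (suc ∘ ρ) u)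
  (poly-+ (poly-+ (poly-* poly-id (poly-+ (poly-const (1 + cost (at 1)))
             (poly-+ (poly-const (setTime (cons (hd (at 1)) (var zero))))
               (poly-+ (poly-time (inLoop ρ) b) (poly-const _)))))
           (poly-const _))
    (poly-const _)))
poly-time ρ (call f σ)   = poly-time (ρ ∘ lookup σ) f

-- Straight-line terms can be run by normalisation.

straight : Term ν → Bool
straight (var i)      = true
straight nil          = true
straight (cons t u)   = straight t ∧ straight u
straight (hd t)       = straight t
straight (tl t)       = straight t
straight (ite t u v)  = straight t ∧ (straight u ∧ straight v)
straight (bind t u)   = straight t ∧ straight u
straight (fold t u b) = false
straight (call f σ)   = straight f

choose : Tree → Tree → Tree → Tree
choose nil     x y = y
choose (_ ∙ _) x y = x

-- On loops the result is a dummy.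
result : Term ν → Vec Tree ν → Tree
result (var i)      Γ = lookup Γ i
result nil          Γ = nil
result (cons t u)   Γ = result t Γ ∙ result u Γ
result (hd t)       Γ = left (result t Γ)
result (tl t)       Γ = right (result t Γ)
result (ite t u v)  Γ = choose (result t Γ) (result u Γ) (result v Γ)
result (bind t u)   Γ = result u (result t Γ ∷ Γ)
result (fold t u b) Γ = nil
result (call f σ)   Γ = result f (map (lookup Γ) σ)

module Rules (N : ℕ) where
  open Evaluation N public

  eval : ∀ (t : Term ν) {Γ} → {T (straight t)} → Γ ⊢ t ⇓ result t Γ
  eval (var i) = var i
  eval nil = nil
  eval (cons t u) {_} {s} = let p , q = Equivalence.to T-∧ s in cons (eval t {_} {p}) (eval u {_} {q})
  eval (hd t) {_} {s} = hd (eval t {_} {s})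
  eval (tl t) {_} {s} = tl (eval t {_} {s})
  eval (ite t u v) {Γ} {s} with Equivalence.to (T-∧ {straight t}) s
  ... | p , s′ with Equivalence.to (T-∧ {straight u}) s′ | result t Γ in eq
  ...   | q , r | nil   = ite-false (subst (Γ ⊢ t ⇓_) eq (eval t {_} {p})) (eval v {_} {r})
  ...   | q , r | _ ∙ _ = ite-true (subst (Γ ⊢ t ⇓_) eq (eval t {_} {p})) (eval u {_} {q})
  eval (bind t u) {_} {s} =
    let p , q = Equivalence.to (T-∧ {straight t}) s in bind (eval t {_} {p}) (eval u {_} {q})
  eval (call f σ) {_} {s} = call (eval f {_} {s})

  castᴿ : ∀ {Γ : Vec Tree ν} {t x y} → x ≡ y → Γ ⊢ t ⇓ x → Γ ⊢ t ⇓ y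
  castᴿ refl d = d

  castᴸ : ∀ {Γ : Vec Tree ν} {b xs a k x y} → x ≡ y → Loop Γ b xs a k x → Loop Γ b xs a k y
  castᴸ refl l = l

  ⇓-if : ∀ {Γ : Vec Tree ν} {t u v x y} c → Γ ⊢ t ⇓ encodeBool c →
         (T c → Γ ⊢ u ⇓ x) → Γ ⊢ v ⇓ y → Γ ⊢ ite t u v ⇓ choose (encodeBool c) x y
  ⇓-if true  d e f = ite-true d (e _)
  ⇓-if false d e f = ite-false d f

  loop-foldl : ∀ {A B : Set} {encA : A → Tree} {encB : B → Tree} {f : B → A → B}
               {Γ : Vec Tree ν} {body} →
               (∀ a b → (encA a ∷ encB b ∷ Γ) ⊢ body ⇓ encB (f b a)) →
               ∀ as b → Loop Γ body (encodeList encA as) (encB b) (length as) (encB (foldl f b as))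
  loop-foldl step [] b = done
  loop-foldl step (a ∷ as) b = next (step a b) (loop-foldl step as _)

-- The algorithm


true′ : Term ν
true′ = cons nil nil

reverseT : Term 1
reverseT = fold (var 0F) nil (cons (var 0F) (var 1F))

-- `fold` consumes a list from the left; reversing first keeps the order of lists that are rebuilt.
foldrT : Term ν → Term ν → Term (2 + ν) → Term ν
foldrT t z b = fold (bind t (call reverseT (zero ∷ []))) z b

anyT : Term ν → Term (2 + ν) → Term ν
anyT t p = foldrT t nil (ite p true′ (var (suc zero)))

filterT : Term ν → Term (2 + ν) → Term ν
filterT t p = foldrT t nil (ite p (cons (var zero) (var (suc zero))) (var (suc zero)))

module Programs (N : ℕ) where
  open Rules N

  reverseᴿ : ∀ {enc : A → Tree} (as : List A) → length as ≤ N →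
             (encodeList enc as ∷ []) ⊢ reverseT ⇓ encodeList enc (reverse as)
  reverseᴿ {enc = enc} as as≤N = fold (var 0F) nil
    (loop-foldl {encA = enc} {encB = encodeList enc} (λ a as → eval (cons (var 0F) (var 1F))) as []) as≤N

  foldrᴿ : ∀ {encA : A → Tree} {encB : B → Tree} {f : A → B → B} {Γ : Vec Tree ν} {t z body} →
           ∀ {as b} → Γ ⊢ t ⇓ encodeList encA as → length as ≤ N → Γ ⊢ z ⇓ encB b →
           (∀ a b → (encA a ∷ encB b ∷ Γ) ⊢ body ⇓ encB (f a b)) →
           Γ ⊢ foldrT t z body ⇓ encB (foldr f b as)
  foldrᴿ {encA = encA} {encB = encB} {f = f} {Γ} {as = as} {b} d len≤ e step =
    subst (λ r → Γ ⊢ _ ⇓ encB r) (reverse-foldl (flip f) b as)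
      (fold (bind d (call (reverseᴿ as len≤)))
        e (loop-foldl (λ a b → step a b) (reverse as) b)
        (≤-trans (≤-reflexive (length-reverse as)) len≤))

  anyᴿ : ∀ {encA : A → Tree} {q : A → Bool} {Γ : Vec Tree ν} {t p as} →
         Γ ⊢ t ⇓ encodeList encA as → length as ≤ N →
         (∀ a b → (encA a ∷ encodeBool b ∷ Γ) ⊢ p ⇓ encodeBool (q a)) →
         Γ ⊢ anyT t p ⇓ encodeBool (anyᵇ q as)
  anyᴿ {q = q} d len≤ step = foldrᴿ {encB = encodeBool} d len≤ nil or
    where
    or : ∀ a b → _ ⊢ ite _ true′ (var (suc zero)) ⇓ encodeBool (q a ∨ b)
    or a b with q a | step a b
    ... | true  | e = ite-true e (cons nil nil)
    ... | false | e = ite-false e (var (suc zero))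

  filterᴿ : ∀ {encA : A → Tree} {q : A → Bool} {Γ : Vec Tree ν} {t p as} →
            Γ ⊢ t ⇓ encodeList encA as → length as ≤ N →
            (∀ a bs → (encA a ∷ encodeList encA bs ∷ Γ) ⊢ p ⇓ encodeBool (q a)) →
            Γ ⊢ filterT t p ⇓ encodeList encA (filterᵇ q as)
  filterᴿ {encA = encA} {q} {Γ} {as = as} d len≤ step =
    subst (λ r → Γ ⊢ _ ⇓ encodeList encA r) (fusion as)
      (foldrᴿ {encB = encodeList encA} {f = add} d len≤ nil kept)
    where
    add : _ → List _ → List _
    add a bs with q a
    ... | true  = a ∷ bs
    ... | false = bs
    kept : ∀ a bs → _ ⊢ ite _ _ _ ⇓ encodeList encA (add a bs)
    kept a bs with q a | step a bs
    ... | true  | e = ite-true e (cons (var zero) (var (suc zero)))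
    ... | false | e = ite-false e (var (suc zero))
    fusion : ∀ as → foldr add [] as ≡ filterᵇ q as
    fusion [] = refl
    fusion (a ∷ as) with q a
    ... | true  = cong (a ∷_) (fusion as)
    ... | false = fusion as

-- r is the verdict on equal numbers.

leᵇ : Bool → ℕᵇ → ℕᵇ → Bool
leᵇ r 0ᵇ       0ᵇ       = r
leᵇ r 0ᵇ       2[1+ b ] = true
leᵇ r 0ᵇ       1+[2 b ] = true
leᵇ r 2[1+ a ] 0ᵇ       = false
leᵇ r 1+[2 a ] 0ᵇ       = false
leᵇ r 2[1+ a ] 2[1+ b ] = leᵇ r a b
-- Different parity excludes equality, so r is overridden: 2 + 2a is at most 1 + 2b iff a < b, and 1
-- + 2a is at most 2 + 2b iff a ≤ b.
leᵇ r 2[1+ a ] 1+[2 b ] = leᵇ false a b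
leᵇ r 1+[2 a ] 2[1+ b ] = leᵇ true a b
leᵇ r 1+[2 a ] 1+[2 b ] = leᵇ r a b

digits : ℕᵇ → ℕ
digits 0ᵇ       = 0
digits 2[1+ a ] = suc (digits a)
digits 1+[2 a ] = suc (digits a)

-- The accumulator is the verdict so far ∙ the remaining digits of b.
leBody : Term (2 + ν)
leBody = ite (tl acc)
  (cons (ite (var zero) (ite (hd (tl acc)) (hd acc) true′) (ite (hd (tl acc)) nil (hd acc)))
        (tl (tl acc)))
  nil
  where acc = var (suc zero)

-- A bijective numeral with more digits is larger. If b runs out first, the accumulator becomes
-- `nil` for good, which reads as false; digits of b left over read as true.
leT : Term 3
leT = bind (fold (var 1F) (cons (var 0F) (var 2F)) leBody) (ite (tl (var 0F)) true′ (hd (var 0F)))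

-- The accumulator is the verdict ∙ the levels left to compare ∙ the rest of y;
-- a decision empties the list of levels.
descendsBody : Term (2 + ν)
descendsBody = ite js (ite d (ite (hd d) (ite (hd e) same greater)
                                        (ite e (ite (hd e) nil down) greater))
                            (ite e nil same))
                     acc
  where
  d       = var zero
  acc     = var (suc zero)
  js       = hd (tl acc)
  y       = tl (tl acc)
  e       = hd y
  same    = cons (hd acc) (cons js (tl y))
  down    = cons (hd acc) (cons (tl js) (tl y))
  greater = cons true′ nil

-- Levels left over at the end mean that the codes coincide but contain too few `mid`, where
-- `descends` is false.
descendsT : Term 4
descendsT = bind (fold (var 2F) (cons (var 0F) (cons (var 1F) (var 3F))) descendsBody)
                 (ite (hd (tl (var 0F))) nil (hd (var 0F)))

encodeDigit : Digit → Tree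
encodeDigit lo  = nil
encodeDigit mid = nil ∙ nil
encodeDigit hi  = (nil ∙ nil) ∙ nil

encodeCode : Code m → Tree
encodeCode []      = nil
encodeCode (d ∷ x) = encodeDigit d ∙ encodeCode x

module Comparisons (N : ℕ) where
  open Rules N

  module _ {Γ : Vec Tree ν} where

    le-stuck : ∀ a → Loop Γ leBody (encodeBin a) nil (digits a) nil
    le-stuck 0ᵇ       = done
    le-stuck 2[1+ a ] = next (eval leBody) (le-stuck a)
    le-stuck 1+[2 a ] = next (eval leBody) (le-stuck a)

    le-loop : ∀ r a b → ∃[ s ] Loop Γ leBody (encodeBin a) (encodeBool r ∙ encodeBin b) (digits a) s ×
                               choose (right s) (nil ∙ nil) (left s) ≡ encodeBool (leᵇ r a b)
    le-loop r 0ᵇ       0ᵇ       = _ , done , refl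
    le-loop r 0ᵇ       2[1+ b ] = _ , done , refl
    le-loop r 0ᵇ       1+[2 b ] = _ , done , refl
    le-loop r 2[1+ a ] 0ᵇ       = _ , next (eval leBody) (le-stuck a) , refl
    le-loop r 1+[2 a ] 0ᵇ       = _ , next (eval leBody) (le-stuck a) , refl
    le-loop r 2[1+ a ] 2[1+ b ] = let s , l , eq = le-loop r a b in s , next (eval leBody) l , eq
    le-loop r 2[1+ a ] 1+[2 b ] = let s , l , eq = le-loop false a b in s , next (eval leBody) l , eq
    le-loop r 1+[2 a ] 2[1+ b ] = let s , l , eq = le-loop true a b in s , next (eval leBody) l , eq
    le-loop r 1+[2 a ] 1+[2 b ] = let s , l , eq = le-loop r a b in s , next (eval leBody) l , eq

  leᴿ : ∀ r a b → digits a ≤ N →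
        (encodeBool r ∷ encodeBin a ∷ encodeBin b ∷ []) ⊢ leT ⇓ encodeBool (leᵇ r a b)
  leᴿ r a b a≤N = let s , l , eq = le-loop r a b in
    castᴿ eq
      (bind (fold (var 1F) (eval (cons (var 0F) (var 2F))) l a≤N)
            (eval (ite (tl (var 0F)) true′ (hd (var 0F)))))

  module _ {Γ : Vec Tree ν} {encA : A → Tree} where

    descends-stuck : ∀ (x : Code m) s → left (right s) ≡ nil →
                     Loop Γ descendsBody (encodeCode x) s m s
    descends-stuck [] s eq = done
    descends-stuck (d ∷ x) s eq =
      next (ite-false (castᴿ eq (eval (hd (tl (var (suc zero)))))) (var (suc zero)))
           (descends-stuck x s eq)

    descends-loop : ∀ r (js : List A) (x y : Code m) →
      ∃[ s ] Loop Γ descendsBody (encodeCode x) (encodeBool r ∙ encodeList encA js ∙ encodeCode y) m s ×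
             choose (left (right s)) nil (left s) ≡ encodeBool (descends r (length js) x y)
    descends-loop r [] x y = _ , descends-stuck x _ refl , refl
    descends-loop r (j ∷ js) [] [] = _ , done , refl
    descends-loop r (j ∷ js) (lo ∷ x) (lo ∷ y) =
      let s , l , eq = descends-loop r (j ∷ js) x y in s , next (eval descendsBody) l , eq
    descends-loop r (j ∷ js) (lo ∷ x) (mid ∷ y) =
      _ , next (eval descendsBody) (descends-stuck x _ refl) , refl
    descends-loop r (j ∷ js) (lo ∷ x) (hi ∷ y) =
      _ , next (eval descendsBody) (descends-stuck x _ refl) , refl
    descends-loop r (j ∷ js) (mid ∷ x) (lo ∷ y) =
      _ , next (eval descendsBody) (descends-stuck x _ refl) , refl
    descends-loop r (j ∷ js) (mid ∷ x) (mid ∷ y) =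
      let s , l , eq = descends-loop r js x y in s , next (eval descendsBody) l , eq
    descends-loop r (j ∷ js) (mid ∷ x) (hi ∷ y) =
      _ , next (eval descendsBody) (descends-stuck x _ refl) , refl
    descends-loop r (j ∷ js) (hi ∷ x) (lo ∷ y) =
      _ , next (eval descendsBody) (descends-stuck x _ refl) , refl
    descends-loop r (j ∷ js) (hi ∷ x) (mid ∷ y) =
      _ , next (eval descendsBody) (descends-stuck x _ refl) , refl
    descends-loop r (j ∷ js) (hi ∷ x) (hi ∷ y) =
      let s , l , eq = descends-loop r (j ∷ js) x y in s , next (eval descendsBody) l , eq

  descendsᴿ : ∀ {encA : A → Tree} r (js : List A) (x y : Code m) → m ≤ N →
              (encodeBool r ∷ encodeList encA js ∷ encodeCode x ∷ encodeCode y ∷ []) ⊢ descendsT ⇓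
              encodeBool (descends r (length js) x y)
  descendsᴿ r js x y m≤N = let s , l , eq = descends-loop r js x y in
    castᴿ eq
      (bind (fold (var 2F) (eval (cons (var 0F) (cons (var 1F) (var 3F)))) l m≤N)
            (eval (ite (hd (tl (var 0F))) nil (hd (var 0F)))))


-- Order and parity of binary numerals

T-ext : ∀ {a b} → (T a → T b) → (T b → T a) → a ≡ b
T-ext {true}  {true}  f g = refl
T-ext {true}  {false} f g = ⊥-elim (f tt)
T-ext {false} {true}  f g = ⊥-elim (g tt)
T-ext {false} {false} f g = refl

does⁺ : {P : Set} (p? : Dec P) → P → T (does p?)
does⁺ p? p = subst T (sym (dec-true p? p)) tt

does⁻ : {P : Set} (p? : Dec P) → T (does p?) → P
does⁻ (yes p) _ = p

≤ᴮ⇒ : ∀ r a b → T (leᵇ r a b) → a ℕᵇ.< b ⊎ (T r × a ≡ b)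
≤ᴮ⇒ r 0ᵇ 0ᵇ t = inj₂ (t , refl)
≤ᴮ⇒ r 0ᵇ 2[1+ b ] t = inj₁ 0<even
≤ᴮ⇒ r 0ᵇ 1+[2 b ] t = inj₁ 0<odd
≤ᴮ⇒ r 2[1+ a ] 2[1+ b ] t with ≤ᴮ⇒ r a b t
... | inj₁ lt          = inj₁ (even<even lt)
... | inj₂ (tr , refl) = inj₂ (tr , refl)
≤ᴮ⇒ r 2[1+ a ] 1+[2 b ] t with ≤ᴮ⇒ false a b t
... | inj₁ lt          = inj₁ (even<odd lt)
≤ᴮ⇒ r 1+[2 a ] 2[1+ b ] t with ≤ᴮ⇒ true a b t
... | inj₁ lt          = inj₁ (odd<even (inj₁ lt))
... | inj₂ (_ , refl)  = inj₁ (odd<even (inj₂ refl))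
≤ᴮ⇒ r 1+[2 a ] 1+[2 b ] t with ≤ᴮ⇒ r a b t
... | inj₁ lt          = inj₁ (odd<odd lt)
... | inj₂ (tr , refl) = inj₂ (tr , refl)

≤ᴮ⇐ : ∀ r a b → a ℕᵇ.< b ⊎ (T r × a ≡ b) → T (leᵇ r a b)
≤ᴮ⇐ r 0ᵇ 0ᵇ (inj₂ (t , _)) = t
≤ᴮ⇐ r 0ᵇ 2[1+ b ] _ = tt
≤ᴮ⇐ r 0ᵇ 1+[2 b ] _ = tt
≤ᴮ⇐ r 2[1+ a ] 2[1+ b ] (inj₁ (even<even lt)) = ≤ᴮ⇐ r a b (inj₁ lt)
≤ᴮ⇐ r 2[1+ a ] 2[1+ b ] (inj₂ (t , refl)) = ≤ᴮ⇐ r a a (inj₂ (t , refl))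
≤ᴮ⇐ r 2[1+ a ] 1+[2 b ] (inj₁ (even<odd lt)) = ≤ᴮ⇐ false a b (inj₁ lt)
≤ᴮ⇐ r 1+[2 a ] 2[1+ b ] (inj₁ (odd<even (inj₁ lt))) = ≤ᴮ⇐ true a b (inj₁ lt)
≤ᴮ⇐ r 1+[2 a ] 2[1+ b ] (inj₁ (odd<even (inj₂ eq))) = ≤ᴮ⇐ true a b (inj₂ (tt , eq))
≤ᴮ⇐ r 1+[2 a ] 1+[2 b ] (inj₁ (odd<odd lt)) = ≤ᴮ⇐ r a b (inj₁ lt)
≤ᴮ⇐ r 1+[2 a ] 1+[2 b ] (inj₂ (t , refl)) = ≤ᴮ⇐ r a a (inj₂ (t , refl))

leᵇ-≤ᵇ : ∀ a b → leᵇ true (fromℕ a) (fromℕ b) ≡ (a ≤ᵇ b)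
leᵇ-≤ᵇ a b = T-ext (λ t → ≤⇒≤ᵇ (to (≤ᴮ⇒ true _ _ t)))
  (λ t → ≤ᴮ⇐ true _ _ (from (m≤n⇒m<n∨m≡n (≤ᵇ⇒≤ a b t))))
  where
  to : fromℕ a ℕᵇ.< fromℕ b ⊎ (⊤ × fromℕ a ≡ fromℕ b) → a ≤ b
  to (inj₁ lt)       = <⇒≤ (fromℕ-cancel-< lt)
  to (inj₂ (_ , eq)) = ≤-reflexive (fromℕ-injective eq)
  from : a < b ⊎ a ≡ b → fromℕ a ℕᵇ.< fromℕ b ⊎ (⊤ × fromℕ a ≡ fromℕ b)
  from (inj₁ lt) = inj₁ (fromℕ-mono-< lt)
  from (inj₂ eq) = inj₂ (tt , cong fromℕ eq)

leᵇ-<ᵇ : ∀ a b → leᵇ false (fromℕ a) (fromℕ b) ≡ (a <ᵇ b)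
leᵇ-<ᵇ a b = T-ext (λ t → <⇒<ᵇ (to (≤ᴮ⇒ false _ _ t)))
  (λ t → ≤ᴮ⇐ false _ _ (inj₁ (fromℕ-mono-< (<ᵇ⇒< a b t))))
  where
  to : fromℕ a ℕᵇ.< fromℕ b ⊎ (⊥ × fromℕ a ≡ fromℕ b) → a < b
  to (inj₁ lt) = fromℕ-cancel-< lt

left-encodeBin : ∀ b → left (encodeBin b) ≡ encodeBool (not (isEven (toℕ b)))
left-encodeBin 0ᵇ = refl
left-encodeBin 2[1+ b ] = cong (encodeBool ∘ not) (sym (dec-true (2 ∣? _) (m∣m*n (suc (toℕ b)))))
left-encodeBin 1+[2 b ] = cong (encodeBool ∘ not) (sym (dec-false (2 ∣? _) λ d →
  1+n≢n (suc-injective (∣1⇒≡1 (∣m+n∣m⇒∣n (subst (2 ∣_) (+-comm 1 (2 * toℕ b)) d) (m∣m*n (toℕ b)))))))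

-- The terms of the solver

agreeT : Term 2
agreeT = ite (var 0F) (var 1F) (ite (var 1F) nil true′)

equalT : Term 2
equalT = bind true′ (bind nil
  (ite (call leT (1F ∷ 2F ∷ 3F ∷ [])) (ite (call leT (0F ∷ 2F ∷ 3F ∷ [])) nil true′) nil))

badOddT : Term 2
badOddT = ite (hd (var 0F)) nil (anyT (var 1F) (call equalT (0F ∷ 2F ∷ [])))

evenColoursT : Term 2
evenColoursT = filterT (var 0F) (call badOddT (0F ∷ 3F ∷ []))

-- The result stays a list: its length is the number of levels, which `descendsT` counts down by
-- dropping elements.
rankT : Term 2
rankT = bind true′ (filterT (var 2F) (call leT (2F ∷ 3F ∷ 0F ∷ [])))

-- The accumulator is a parity flag ∙ half the number of elements seen, in unary.
halfBody : Term (2 + ν)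
halfBody = ite (hd acc) (cons nil (cons nil (tl acc))) (cons true′ (tl acc))
  where acc = var (suc zero)

halfT : Term 1
halfT = tl (fold (var 0F) (cons nil nil) halfBody)

-- The accumulator is the number still to be halved ∙ the number of halvings. The loop runs over the
-- vertices, which gives enough rounds, and idles once 0 is reached.
lgBody : Term (2 + ν)
lgBody = ite (hd (var (suc zero)))
  (bind (hd (var (suc zero))) (cons (call halfT (zero ∷ [])) (cons nil (tl (var (suc (suc zero)))))))
  (var (suc zero))

lgT : Term 1
lgT = bind (foldrT (var 0F) nil (cons nil (var 1F)))
           (tl (fold (var 1F) (cons (var 0F) nil) lgBody))

prefix : Digit → Term ν
prefix lo  = nil
prefix mid = true′
prefix hi  = cons true′ nil

extendT : Term 1
extendT = foldrT (var 0F) nil (cons (cons (prefix lo) (var 0F)) (cons (cons (prefix mid) (var 0F))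
  (cons (cons (prefix hi) (var 0F)) (var 1F))))

stringsT : Term 2
stringsT = fold (var 0F) (fold (var 1F) (cons nil nil) (call extendT (1F ∷ []))) (call extendT (1F ∷ []))

supportT : Term 5
supportT = bind (anyT (var 4F) (call descendsT (3F ∷ 4F ∷ 5F ∷ 0F ∷ []))) (call agreeT (1F ∷ 0F ∷ []))

-- The accumulator is the entries of the remaining vertices ∙ the verdict so far.
keepBody : Term 8
keepBody = cons (tl (hd (var 1F)))
  (ite (var 0F)
    (bind (tl (hd (hd (var 1F))))
      (ite (call supportT (3F ∷ 5F ∷ 6F ∷ 7F ∷ 0F ∷ [])) true′ (tl (var 2F))))
    (tl (var 1F)))

keepT : Term 6
keepT = bind (tl (fold (var 1F) (cons (var 5F) nil) keepBody)) (call agreeT (1F ∷ 0F ∷ []))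

-- The entry of a vertex is (owner ∙ row of the edge matrix ∙ colour) ∙ alive codes.
entryT : Term 3
entryT = bind (tl (tl (hd (var 0F))))
  (bind (call rankT (0F ∷ 3F ∷ []))
  (bind (hd (var 1F))
  (bind (hd (hd (var 3F)))
  (bind (hd (tl (hd (var 4F))))
  (cons (hd (var 5F))
        (filterT (tl (var 5F)) (call keepT (3F ∷ 2F ∷ 4F ∷ 5F ∷ 0F ∷ 8F ∷ []))))))))

stepT : Term 2
stepT = foldrT (var 0F) nil (cons (call entryT (0F ∷ 2F ∷ 3F ∷ [])) (var 1F))

-- The accumulator is (rows ∙ colours) still to be read ∙ the finished entries in reverse order;
-- `var 5F` is the list of all codes.
startBody : Term 6
startBody = cons (cons (tl (hd (hd acc))) (tl (tl (hd acc))))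
  (cons (cons (cons (var 0F) (cons (hd (hd (hd acc))) (hd (tl (hd acc))))) (var 5F)) (tl acc))
  where acc = var 1F

startT : Term 4
startT = bind (tl (fold (var 0F) (cons (cons (var 1F) (var 2F)) nil) startBody)) (call reverseT (0F ∷ []))

winnersT : Term 1
winnersT = foldrT (var 0F) nil (cons (ite (tl (var 0F)) true′ nil) (var 1F))

mainT : Term 1
mainT = bind (hd (var 0F))
  (bind (hd (tl (var 1F)))
  (bind (tl (tl (tl (var 2F))))
  (bind (hd (tl (tl (var 3F))))
  (bind (call evenColoursT (0F ∷ 1F ∷ []))
  (bind (call lgT (4F ∷ []))
  (bind (call stringsT (1F ∷ 0F ∷ []))
  (bind (call startT (6F ∷ 5F ∷ 4F ∷ 0F ∷ []))
  -- The owners and the codes are traversed only to count rounds.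
  (bind (fold (var 7F) (var 0F) (fold (var 3F) (var 1F) (call stepT (1F ∷ 7F ∷ []))))
        (call winnersT (0F ∷ []))))))))))

unary : ℕ → Tree
unary k = encodeList (const nil) (replicateˡ k tt)

lgStep : ℕ × ℕ → ℕ × ℕ
lgStep (zero  , l) = zero , l
lgStep (suc c , l) = ⌊ suc c /2⌋ , suc l

-- The bit length of n. The rounded-down logarithm would be one too small, since the embedding asks
-- for n < 2 ^ l.
lg : ℕ → ℕ
lg n = proj₂ (iterate lgStep n (n , 0))

strings : ∀ m → List (Code m)
extend : List (Code m) → List (Code (suc m))
extend = foldr (λ x xs → (lo ∷ x) ∷ (mid ∷ x) ∷ (hi ∷ x) ∷ xs) []
strings zero    = [] ∷ []
strings (suc m) = extend (strings m)

extend-∈ : ∀ {x : Code m} {xs} d → x ∈ xs → (d ∷ x) ∈ extend xs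
extend-∈ lo  (here refl) = here refl
extend-∈ mid (here refl) = there (here refl)
extend-∈ hi  (here refl) = there (there (here refl))
extend-∈ d   (there i)   = there (there (there (extend-∈ d i)))

strings-complete : ∀ (x : Code m) → x ∈ strings m
strings-complete []      = here refl
strings-complete (d ∷ x) = extend-∈ d (strings-complete x)

n≤3^n : ∀ n → n ≤ 3 ^ n
n≤3^n n = ≤-trans (<⇒≤ (n<2^n n)) (^-monoˡ-≤ n (s≤s (s≤s z≤n)))

length-extend : ∀ (xs : List (Code m)) → length (extend xs) ≡ length xs * 3
length-extend []       = refl
length-extend (x ∷ xs) = cong (3 +_) (length-extend xs)

length-strings : ∀ m → length (strings m) ≡ 3 ^ m
length-strings zero    = refl
length-strings (suc m) = trans (length-extend (strings m))
  (trans (cong (_* 3) (length-strings m)) (*-comm (3 ^ m) 3))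

encodeList-map : (enc : B → Tree) (f : A → B) → ∀ xs → encodeList enc (mapˡ f xs) ≡ encodeList (enc ∘ f) xs
encodeList-map enc f []       = refl
encodeList-map enc f (x ∷ xs) = cong (enc (f x) ∙_) (encodeList-map enc f xs)

encodeList-cong : {enc enc′ : A → Tree} → (∀ x → enc x ≡ enc′ x) → ∀ xs →
                  encodeList enc xs ≡ encodeList enc′ xs
encodeList-cong eq []       = refl
encodeList-cong eq (x ∷ xs) = cong₂ _∙_ (eq x) (encodeList-cong eq xs)

encodeList-tabulate : (enc : B → Tree) (f : Fin ν → B) →
                      encodeList enc (tabulate f) ≡ encodeList (enc ∘ f) (allFin ν)
encodeList-tabulate enc f =
  trans (cong (encodeList enc) (sym (map-tabulate id f))) (encodeList-map enc f (allFin _))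

iterate-+ : (f : A → A) → ∀ a b x → iterate f (a + b) x ≡ iterate f b (iterate f a x)
iterate-+ f zero    b x = refl
iterate-+ f (suc a) b x = iterate-+ f a b (f x)

module Auxiliary (N : ℕ) where
  open Rules N
  open Programs N
  open Comparisons N

  agreeᴿ : ∀ p b → (encodePlayer p ∷ encodeBool b ∷ []) ⊢ agreeT ⇓ encodeBool (agree p b)
  agreeᴿ even true  = eval agreeT
  agreeᴿ even false = eval agreeT
  agreeᴿ odd  true  = eval agreeT
  agreeᴿ odd  false = eval agreeT

  equalᴿ : ∀ a b → digits (fromℕ a) ≤ N →
           (encodeℕ a ∷ encodeℕ b ∷ []) ⊢ equalT ⇓ encodeBool (does (a ≟ⁿ b))
  equalᴿ a b a≤N = castᴿ meaning (bind (eval true′) (bind nil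
    (⇓-if _ (call (leᴿ true (fromℕ a) (fromℕ b) a≤N))
            (λ _ → ⇓-if _ (call (leᴿ false (fromℕ a) (fromℕ b) a≤N)) (λ _ → nil) (eval true′))
            nil)))
    where
    meaning : choose (encodeBool (leᵇ true (fromℕ a) (fromℕ b)))
              (choose (encodeBool (leᵇ false (fromℕ a) (fromℕ b))) nil (nil ∙ nil)) nil ≡
            encodeBool (does (a ≟ⁿ b))
    meaning rewrite leᵇ-≤ᵇ a b | leᵇ-<ᵇ a b
      with a ≤ᵇ b in le | a <ᵇ b in lt
    ... | false | _     = cong encodeBool (sym (dec-false (a ≟ⁿ b) λ { refl →
                            subst T le (≤⇒≤ᵇ (≤-refl {a})) }))
    ... | true  | true  = cong encodeBool (sym (dec-false (a ≟ⁿ b)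
                            (<⇒≢ (<ᵇ⇒< a b (subst T (sym lt) tt)))))
    ... | true  | false = cong encodeBool (sym (dec-true (a ≟ⁿ b)
                            (≤-antisym (≤ᵇ⇒≤ a b (subst T (sym le) tt))
                                       (≮⇒≥ λ a<b → subst T lt (<⇒<ᵇ a<b)))))

  half-loop : ∀ {Γ : Vec Tree ν} k c →
    ∃[ b ] Loop Γ halfBody (unary c) (nil ∙ unary k) c (b ∙ unary (⌊ c /2⌋ + k))
  half-loop k zero          = _ , done
  half-loop k (suc zero)    = _ , next (eval halfBody) done
  half-loop k (suc (suc c)) = let b , l = half-loop (suc k) c in
    b , next (eval halfBody) (next (eval halfBody)
          (castᴸ (cong (λ j → b ∙ unary j) (+-suc ⌊ c /2⌋ k)) l))

  halfᴿ : ∀ c → c ≤ N → (unary c ∷ []) ⊢ halfT ⇓ unary ⌊ c /2⌋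
  halfᴿ c c≤N = castᴿ (cong unary (+-identityʳ _))
    (tl (fold (var 0F) (cons nil nil) (proj₂ (half-loop 0 c)) c≤N))

  encodeLg : ℕ × ℕ → Tree
  encodeLg (c , l) = unary c ∙ unary l

  lg-loop : ∀ {Γ : Vec Tree ν} {enc : A → Tree} (as : List A) s → proj₁ s ≤ N →
            Loop Γ lgBody (encodeList enc as) (encodeLg s) (length as)
                 (encodeLg (iterate lgStep (length as) s))
  lg-loop [] s _ = done
  lg-loop (a ∷ as) (zero , l) _ =
    next (ite-false (eval (hd (var (suc zero)))) (var (suc zero))) (lg-loop as (zero , l) z≤n)
  lg-loop (a ∷ as) (suc c , l) c≤N =
    next (ite-true (eval (hd (var (suc zero)))) (bind (eval (hd (var (suc zero))))
           (cons (call (halfᴿ (suc c) c≤N)) (eval (cons nil (tl (var (suc (suc zero)))))))))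
         (lg-loop as _ (≤-trans (⌊n/2⌋≤n (suc c)) c≤N))

  lgᴿ : ∀ {enc : A → Tree} (as : List A) → length as ≤ N →
        (encodeList enc as ∷ []) ⊢ lgT ⇓ unary (lg (length as))
  lgᴿ {enc = enc} as as≤N = bind
    (foldrᴿ {encB = unary} {f = const suc} (var 0F) as≤N nil λ a k → eval (cons nil (var 1F)))
    (tl (fold (var 1F) (eval (cons (var 0F) nil)) (lg-loop {enc = enc} as _ as≤N) as≤N))

  extendᴿ : (xs : List (Code m)) → length xs ≤ N →
            (encodeList encodeCode xs ∷ []) ⊢ extendT ⇓ encodeList encodeCode (extend xs)
  extendᴿ xs xs≤N = foldrᴿ {encB = encodeList encodeCode} (var 0F) xs≤N nil λ x ys →
    eval (cons (cons (prefix lo) (var 0F)) (cons (cons (prefix mid) (var 0F))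
           (cons (cons (prefix hi) (var 0F)) (var 1F))))

  strings-loop : ∀ {Γ : Vec Tree ν} {enc : A → Tree} (as : List A) k → 3 ^ (length as + k) ≤ N →
    Loop Γ (call extendT (suc zero ∷ [])) (encodeList enc as) (encodeList encodeCode (strings k))
         (length as) (encodeList encodeCode (strings (length as + k)))
  strings-loop [] k _ = done
  strings-loop (a ∷ as) k ≤N = next
    (call (extendᴿ (strings k) (≤-trans (≤-reflexive (length-strings k))
                                        (≤-trans (^-monoʳ-≤ 3 (m≤n+m k (suc (length as)))) ≤N))))
    (castᴸ (cong (λ j → encodeList encodeCode (strings j)) (+-suc (length as) k))
      (strings-loop as (suc k) (≤-trans (≤-reflexive (cong (3 ^_) (+-suc (length as) k))) ≤N)))

  stringsᴿ : ∀ {enc : A → Tree} {enc′ : B → Tree} (as : List A) (bs : List B) →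
             3 ^ (length as + length bs) ≤ N →
             (encodeList enc as ∷ encodeList enc′ bs ∷ []) ⊢ stringsT ⇓
             encodeList encodeCode (strings (length as + length bs))
  stringsᴿ {enc = enc} {enc′} as bs ≤N = fold (var 0F)
    (fold (var 1F) (eval (cons nil nil))
      (castᴸ (cong (λ j → encodeList encodeCode (strings j)) (+-identityʳ (length bs)))
        (strings-loop {enc = enc′} bs 0 (≤-trans (≤-reflexive (cong (3 ^_) (+-identityʳ (length bs))))
           (≤-trans (^-monoʳ-≤ 3 {length bs} (m≤n+m (length bs) (length as))) ≤N))))
      (≤-trans (m≤n+m _ (length as)) small))
    (strings-loop {enc = enc} as (length bs) ≤N)
    (≤-trans (m≤m+n _ (length bs)) small)
    where
    small : length as + length bs ≤ N
    small = ≤-trans (n≤3^n _) ≤N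

-- Correctness of the solver on a game

module Solver (G : ParityGame) (N : ℕ)
              (n≤N : ParityGame.n G ≤ N) (C≤N : length (ParityGame.C G) ≤ N)
              (φ≤N : ∀ v → digits (fromℕ (ParityGame.φ G v)) ≤ N) where
  open ParityGame G
  open Game G
  open Rules N
  open Programs N
  open Comparisons N
  open Auxiliary N

  Vs : List V
  Vs = allFin n

  Vs≤N : length Vs ≤ N
  Vs≤N = ≤-trans (≤-reflexive (length-tabulate id)) n≤N

  colours : Tree
  colours = encodeList (encodeℕ ∘ φ) Vs

  badOddᴿ : ∀ c → (encodeℕ c ∷ colours ∷ []) ⊢ badOddT ⇓ encodeBool (bad odd c)
  badOddᴿ c = castᴿ meaning (⇓-if (not (isEven c)) (castᴿ oddness (hd (var 0F))) (λ _ → nil)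
    (anyᴿ {q = λ v → does (φ v ≟ⁿ c)} (var 1F) Vs≤N (λ v b → call (equalᴿ (φ v) c (φ≤N v)))))
    where
    oddness : left (encodeℕ c) ≡ encodeBool (not (isEven c))
    oddness = trans (left-encodeBin (fromℕ c)) (cong (encodeBool ∘ not ∘ isEven) (toℕ-fromℕ c))
    used-any : anyᵇ (λ v → does (φ v ≟ⁿ c)) Vs ≡ used c
    used-any = T-ext
      (λ t → let v , _ , u = anyᵇ⁻ Vs t in does⁺ (any? _) (v , does⁻ (φ v ≟ⁿ c) u))
      (λ t → let v , eq = does⁻ (any? λ v → φ v ≟ⁿ c) t in anyᵇ⁺ (∈-allFin v) (does⁺ (φ v ≟ⁿ c) eq))
    meaning : choose (encodeBool (not (isEven c))) nil (encodeBool (anyᵇ (λ v → does (φ v ≟ⁿ c)) Vs)) ≡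
            encodeBool (bad odd c)
    meaning with isEven c
    ... | true  = cong encodeBool used-any
    ... | false = refl

  evenColoursᴿ : (encodeList encodeℕ C ∷ colours ∷ []) ⊢ evenColoursT ⇓ encodeList encodeℕ evenColours
  evenColoursᴿ = filterᴿ {q = bad odd} (var 0F) C≤N λ c cs → call (badOddᴿ c)

  evenColours≤N : length evenColours ≤ N
  evenColours≤N = ≤-trans (length-filter (T? ∘ bad odd) C) C≤N

  rankᴿ : ∀ v → (encodeℕ (φ v) ∷ encodeList encodeℕ evenColours ∷ []) ⊢ rankT ⇓
                encodeList encodeℕ (filterᵇ (φ v ≤ᵇ_) evenColours)
  rankᴿ v = bind (eval true′) (filterᴿ {q = φ v ≤ᵇ_} (var 2F) evenColours≤N λ c cs →
    castᴿ (cong encodeBool (leᵇ-≤ᵇ (φ v) c)) (call (leᴿ true (fromℕ (φ v)) (fromℕ c) (φ≤N v))))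

  module _ (m : ℕ) (m≤N : m ≤ N) where
    open Fixpoint m

    encodeEntry : Alive → V → Tree
    encodeEntry A v = (encodePlayer (owner v) ∙ encodeList (encodeBool ∘ edge v) Vs ∙ encodeℕ (φ v)) ∙
                      encodeList encodeCode (A v)

    encodeAlive : Alive → Tree
    encodeAlive A = encodeList (encodeEntry A) Vs

    Small : Alive → Set
    Small A = ∀ v → length (A v) ≤ N

    module _ (A : Alive) (small : Small A) (v : V) where

      js : List ℕ
      js = filterᵇ (φ v ≤ᵇ_) evenColours

      r : Bool
      r = not (isEven (φ v))

      supportᴿ : ∀ x w →
        (encodePlayer (owner v) ∷ encodeBool r ∷ encodeList encodeℕ js ∷ encodeCode x ∷
         encodeList encodeCode (A w) ∷ []) ⊢ supportT ⇓
        encodeBool (agree (owner v) (anyᵇ (descendsAt v x) (A w)))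
      supportᴿ x w = bind
        (anyᴿ {q = descendsAt v x} (var 4F) (small w) λ y b → call (descendsᴿ r js x y m≤N))
        (call (agreeᴿ (owner v) _))

      keep-loop : ∀ x (row : Tree) ws b → let
        Γ = encodePlayer (owner v) ∷ row ∷ encodeBool r ∷ encodeList encodeℕ js ∷ encodeCode x ∷
            encodeAlive A ∷ [] in
        Loop Γ keepBody (encodeList (encodeBool ∘ edge v) ws)
             (encodeList (encodeEntry A) ws ∙ encodeBool b) (length ws)
             (nil ∙ encodeBool (anyᵇ (supports A v x) ws ∨ b))
      keep-loop x row [] b = done
      keep-loop x row (w ∷ ws) b = next
        (cons (eval (tl (hd (var 1F))))
          (⇓-if (edge v w) (var 0F)
            (λ _ → bind (eval (tl (hd (hd (var 1F)))))
              (⇓-if _ (call (supportᴿ x w)) (λ _ → eval true′) (eval (tl (var 2F)))))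
            (eval (tl (var 1F)))))
        (subst₂ (λ a z → Loop _ keepBody _ (encodeList (encodeEntry A) ws ∙ a) (length ws) (nil ∙ z))
          (sym (meaning (edge v w) (agree (owner v) (anyᵇ (descendsAt v x) (A w)))))
          (cong encodeBool (accumulate (supports A v x w) (anyᵇ (supports A v x) ws)))
          (keep-loop x row ws (supports A v x w ∨ b)))
        where
        meaning : ∀ e s →
          choose (encodeBool e) (choose (encodeBool s) (nil ∙ nil) (encodeBool b)) (encodeBool b) ≡
          encodeBool (e ∧ s ∨ b)
        meaning true  true  = refl
        meaning true  false = refl
        meaning false _     = refl
        accumulate : ∀ p q → q ∨ (p ∨ b) ≡ (p ∨ q) ∨ b
        accumulate true  q = ∨-zeroʳ q
        accumulate false q = refl

      keepᴿ : ∀ x →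
        (encodePlayer (owner v) ∷ encodeList (encodeBool ∘ edge v) Vs ∷ encodeBool r ∷
         encodeList encodeℕ js ∷ encodeCode x ∷ encodeAlive A ∷ []) ⊢ keepT ⇓ encodeBool (keeps A v x)
      keepᴿ x = bind
        (tl (fold (var 1F) (eval (cons (var 5F) nil)) (keep-loop x _ Vs false) Vs≤N))
        (castᴿ (cong (encodeBool ∘ agree (owner v)) (∨-identityʳ _)) (call (agreeᴿ (owner v) _)))

      entryᴿ : (encodeEntry A v ∷ encodeAlive A ∷ encodeList encodeℕ evenColours ∷ []) ⊢ entryT ⇓
               encodeEntry (step A) v
      entryᴿ = bind (eval (tl (tl (hd (var 0F)))))
        (bind (call (rankᴿ v))
        (bind (castᴿ oddness (eval (hd (var 1F))))
        (bind (eval (hd (hd (var 3F))))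
        (bind (eval (hd (tl (hd (var 4F)))))
        (cons (eval (hd (var 5F)))
              (filterᴿ {q = keeps A v} (eval (tl (var 5F))) (small v) λ x xs → call (keepᴿ x)))))))
        where
        oddness : left (encodeℕ (φ v)) ≡ encodeBool r
        oddness = trans (left-encodeBin (fromℕ (φ v))) (cong (encodeBool ∘ not ∘ isEven) (toℕ-fromℕ (φ v)))

    stepᴿ : ∀ A → Small A →
            (encodeAlive A ∷ encodeList encodeℕ evenColours ∷ []) ⊢ stepT ⇓ encodeAlive (step A)
    stepᴿ A small = castᴿ (cong (encodeList (encodeEntry (step A))) (sym (id-is-foldr Vs)))
      (foldrᴿ {encB = encodeList (encodeEntry (step A))} (var 0F) Vs≤N nil λ v vs →
        cons (call (entryᴿ A small v)) (var 1F))

    small-step : ∀ A → Small A → Small (step A)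
    small-step A small v = ≤-trans (length-filter (T? ∘ keeps A v) (A v)) (small v)

    small-iterate : ∀ k A → Small A → Small (iterate step k A)
    small-iterate zero    A small = small
    small-iterate (suc k) A small = small-iterate k (step A) (small-step A small)

    inner-loop : ∀ {X : Set} {enc : X → Tree} (xs : List X) A → Small A →
                 ∀ {a b c d e f g h i j} → let
                 Γ = a ∷ b ∷ c ∷ d ∷ e ∷ encodeList encodeℕ evenColours ∷ f ∷ g ∷ h ∷ i ∷ j ∷ [] in
                 Loop Γ (call stepT (1F ∷ 7F ∷ [])) (encodeList enc xs) (encodeAlive A) (length xs)
                      (encodeAlive (iterate step (length xs) A))
    inner-loop [] A small = done
    inner-loop (x ∷ xs) A small = next (call (stepᴿ A small)) (inner-loop xs (step A) (small-step A small))

    outer-loop : ∀ (vs : List V) A → Small A → length (strings m) ≤ N →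
                 ∀ {a c d e f g h} → let
                 Γ = a ∷ encodeList encodeCode (strings m) ∷ c ∷ encodeList encodeℕ evenColours ∷
                     d ∷ e ∷ f ∷ g ∷ h ∷ [] in
                 Loop Γ (fold (var 3F) (var 1F) (call stepT (1F ∷ 7F ∷ [])))
                      (encodeList (encodePlayer ∘ owner) vs) (encodeAlive A) (length vs)
                      (encodeAlive (iterate step (length vs * length (strings m)) A))
    outer-loop [] A small _ = done
    outer-loop (v ∷ vs) A small ≤N = next
      (fold (var 3F) (var 1F) (inner-loop (strings m) A small) ≤N)
      (castᴸ (cong encodeAlive (sym (iterate-+ step (length (strings m)) _ A)))
        (outer-loop vs _ (small-iterate (length (strings m)) A small) ≤N))

    full : Alive
    full _ = strings m

    start-loop : ∀ {rows φs os} vs out → let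
      Γ = os ∷ rows ∷ φs ∷ encodeList encodeCode (strings m) ∷ [] in
      Loop Γ startBody (encodeList (encodePlayer ∘ owner) vs)
        ((encodeList (λ v → encodeList (encodeBool ∘ edge v) Vs) vs ∙ encodeList (encodeℕ ∘ φ) vs) ∙
         encodeList (encodeEntry full) out)
        (length vs) ((nil ∙ nil) ∙ encodeList (encodeEntry full) (foldl (flip _∷_) out vs))
    start-loop [] out = done
    start-loop (v ∷ vs) out = next (eval startBody) (start-loop vs (v ∷ out))

    startᴿ : (encodeList (encodePlayer ∘ owner) Vs ∷
              encodeList (λ v → encodeList (encodeBool ∘ edge v) Vs) Vs ∷ colours ∷
              encodeList encodeCode (strings m) ∷ []) ⊢ startT ⇓ encodeAlive full
    startᴿ = bind (tl (fold (var 0F) (eval (cons (cons (var 1F) (var 2F)) nil)) (start-loop Vs []) Vs≤N))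
      (castᴿ (cong (encodeList (encodeEntry full)) (reverse-involutive Vs))
        (call (reverseᴿ (reverse Vs) (≤-trans (≤-reflexive (length-reverse Vs)) Vs≤N))))

    winnersᴿ : ∀ A → (encodeAlive A ∷ []) ⊢ winnersT ⇓ encodeList (encodePlayer ∘ winner ∘ A) Vs
    winnersᴿ A = castᴿ (cong (encodeList (encodePlayer ∘ winner ∘ A)) (sym (id-is-foldr Vs)))
      (foldrᴿ {encB = encodeList (encodePlayer ∘ winner ∘ A)} (var 0F) Vs≤N nil λ v vs →
        cons (nonempty v) (var 1F))
      where
      nonempty : ∀ v {vs} → (encodeEntry A v ∷ vs ∷ encodeAlive A ∷ []) ⊢ ite (tl (var 0F)) true′ nil ⇓
                 encodePlayer (winner (A v))
      nonempty v with A v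
      ... | []    = ite-false (tl (var 0F)) nil
      ... | _ ∷ _ = ite-true (tl (var 0F)) (eval true′)

  encodeGame-lists : encodeGame G ≡
    encodeList (encodePlayer ∘ owner) Vs ∙
    encodeList (λ v → encodeList (encodeBool ∘ edge v) Vs) Vs ∙
    encodeList encodeℕ C ∙ colours
  encodeGame-lists = cong₂ _∙_ (encodeList-tabulate encodePlayer owner)
    (cong₂ (λ rows cs → rows ∙ encodeList encodeℕ C ∙ cs)
      (trans (encodeList-tabulate (encodeList encodeBool) (tabulate ∘ edge))
             (encodeList-cong (λ v → encodeList-tabulate encodeBool (edge v)) Vs))
      (encodeList-tabulate encodeℕ φ))

  levelCount : ℕ
  levelCount = length evenColours + lg n

  open Fixpoint levelCount

  -- A round that changes anything removes one of the |V| * 3 ^ levelCount codes.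
  rounds : ℕ
  rounds = length Vs * length (strings levelCount)

  final : Alive
  final = iterate step rounds (λ _ → strings levelCount)

  module _ (strings≤N : 3 ^ levelCount ≤ N) where

    mainᴿ : (encodeGame G ∷ []) ⊢ mainT ⇓ encodeList (encodePlayer ∘ winner ∘ final) Vs
    mainᴿ = subst (λ g → (g ∷ []) ⊢ mainT ⇓ encodeList (encodePlayer ∘ winner ∘ final) Vs)
      (sym encodeGame-lists)
      (bind (eval (hd (var 0F)))
      (bind (eval (hd (tl (var 1F))))
      (bind (eval (tl (tl (tl (var 2F)))))
      (bind (eval (hd (tl (tl (var 3F)))))
      (bind (call evenColoursᴿ)
      (bind (castᴿ (cong (unary ∘ lg) (length-tabulate {n = n} id)) (call (lgᴿ Vs Vs≤N)))
      (bind (castᴿ (cong (encodeList encodeCode ∘ strings) m≡)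
              (call (stringsᴿ evenColours (replicateˡ (lg n) tt)
               (≤-trans (≤-reflexive (cong (3 ^_) m≡)) strings≤N))))
      (bind (call (startᴿ levelCount m≤N))
      (bind (fold (var 7F) (var 0F)
              (outer-loop levelCount m≤N Vs (full levelCount m≤N) (λ _ → len≤N) len≤N) Vs≤N)
            (call (winnersᴿ levelCount m≤N final)))))))))))
      where
      m≡ : length evenColours + length (replicateˡ (lg n) tt) ≡ levelCount
      m≡ = cong (length evenColours +_) (length-replicate (lg n))
      len≤N : length (strings levelCount) ≤ N
      len≤N = ≤-trans (≤-reflexive (length-strings levelCount)) strings≤N
      m≤N : levelCount ≤ N
      m≤N = ≤-trans (n≤3^n levelCount) strings≤N

  final-correct : n < 2 ^ lg n → ∀ v → winner (final v) ≡ W v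
  final-correct n<2^l = winner-correct
    (iterate-fixed rounds _ (≤-reflexive (sum-const Vs)))
    λ v eq → _ , code-survives cert rounds (λ u _ → strings-complete _) v eq
    where
    cert : Certificate odd levelCount
    cert = subst (λ h → Certificate odd (h + lg n)) levels-odd (certificate odd (lg n) n<2^l)
    sum-const : ∀ vs → sum (mapˡ (λ _ → length (strings levelCount)) vs) ≡
                       length vs * length (strings levelCount)
    sum-const []       = refl
    sum-const (_ ∷ vs) = cong (length (strings levelCount) +_) (sum-const vs)

  encodeSolution-final : n < 2 ^ lg n →
                         encodeList (encodePlayer ∘ winner ∘ final) Vs ≡ encodeSolution G W
  encodeSolution-final n<2^l = sym (trans (encodeList-tabulate encodePlayer W)
    (encodeList-cong (λ v → cong encodePlayer (sym (final-correct n<2^l v))) Vs))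

-- Running time


*-^-distrib : ∀ a b d → (a * b) ^ d ≡ a ^ d * b ^ d
*-^-distrib a b zero    = refl
*-^-distrib a b (suc d) = trans (cong (a * b *_) (*-^-distrib a b d)) ([m*n]*[o*p]≡[m*o]*[n*p] a b _ _)

n≤1+2⌊n/2⌋ : ∀ n → n ≤ 1 + 2 * ⌊ n /2⌋
n≤1+2⌊n/2⌋ zero          = z≤n
n≤1+2⌊n/2⌋ (suc zero)    = ≤-refl
n≤1+2⌊n/2⌋ (suc (suc n)) = ≤-trans (s≤s (s≤s (n≤1+2⌊n/2⌋ n)))
  (≤-reflexive (cong suc (sym (*-suc 2 ⌊ n /2⌋))))

2⌊n/2⌋≤n : ∀ n → 2 * ⌊ n /2⌋ ≤ n
2⌊n/2⌋≤n zero          = z≤n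
2⌊n/2⌋≤n (suc zero)    = z≤n
2⌊n/2⌋≤n (suc (suc n)) = ≤-trans (≤-reflexive (*-suc 2 ⌊ n /2⌋)) (s≤s (s≤s (2⌊n/2⌋≤n n)))

2^⌊log₂n⌋≤n : ∀ n → 1 ≤ n → 2 ^ ⌊log₂ n ⌋ ≤ n
2^⌊log₂n⌋≤n n = go n n ≤-refl
  where
  go : ∀ k n → n ≤ k → 1 ≤ n → 2 ^ ⌊log₂ n ⌋ ≤ n
  go _       (suc zero)      _            _ = ≤-refl
  go (suc k) n@(suc (suc m)) (s≤s 1+m≤k) _ = begin
    2 ^ ⌊log₂ n ⌋                ≤⟨ ^-monoʳ-≤ 2 (m≤n+m∸n ⌊log₂ n ⌋ 1) ⟩
    2 * 2 ^ (⌊log₂ n ⌋ ∸ 1)      ≡⟨ cong (λ l → 2 * 2 ^ l) (⌊log₂⌊n/2⌋⌋≡⌊log₂n⌋∸1 n) ⟨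
    2 * 2 ^ ⌊log₂ ⌊ n /2⌋ ⌋      ≤⟨ *-monoʳ-≤ 2 (go k ⌊ n /2⌋ (≤-trans (s≤s (⌊n/2⌋≤n m)) 1+m≤k) (s≤s z≤n)) ⟩
    2 * ⌊ n /2⌋                  ≤⟨ 2⌊n/2⌋≤n n ⟩
    n                            ∎
    where open ≤-Reasoning

2^⌊log₂n⌋≤1+n : ∀ n → 2 ^ ⌊log₂ n ⌋ ≤ suc n
2^⌊log₂n⌋≤1+n zero    = ≤-refl
2^⌊log₂n⌋≤1+n (suc n) = m≤n⇒m≤1+n (2^⌊log₂n⌋≤n (suc n) (s≤s z≤n))

n<2^lg : ∀ n → n < 2 ^ lg n
n<2^lg n = ≤-trans (≤-reflexive (sym (*-identityʳ (suc n)))) (go n n 0 ≤-refl)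
  where
  -- `suc c * 2 ^ l` never decreases along the loop, and k ≥ c rounds suffice to end with c = 0.
  go : ∀ k c l → c ≤ k → suc c * 2 ^ l ≤ 2 ^ proj₂ (iterate lgStep k (c , l))
  go zero    zero    l _ = ≤-reflexive (*-identityˡ _)
  go (suc k) zero    l _ = go k zero l z≤n
  go (suc k) (suc c) l (s≤s c≤k) = begin
    suc (suc c) * 2 ^ l               ≤⟨ *-monoˡ-≤ (2 ^ l) (s≤s (n≤1+2⌊n/2⌋ (suc c))) ⟩
    (2 + 2 * ⌊ suc c /2⌋) * 2 ^ l     ≡⟨ cong (_* 2 ^ l) (*-suc 2 ⌊ suc c /2⌋) ⟨
    2 * suc ⌊ suc c /2⌋ * 2 ^ l       ≡⟨ cong (_* 2 ^ l) (*-comm 2 (suc ⌊ suc c /2⌋)) ⟩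
    suc ⌊ suc c /2⌋ * 2 * 2 ^ l       ≡⟨ *-assoc (suc ⌊ suc c /2⌋) 2 (2 ^ l) ⟩
    suc ⌊ suc c /2⌋ * 2 ^ suc l       ≤⟨ go k ⌊ suc c /2⌋ (suc l) (≤-trans (≤-pred (⌊n/2⌋<n c)) c≤k) ⟩
    _                                 ∎
    where open ≤-Reasoning

2^lg≤ : ∀ n → 2 ^ lg n ≤ 1 + 2 * n
2^lg≤ n = ≤-trans (go n n 0) (≤-trans (≤-reflexive (*-identityˡ (g n))) (g≤ n))
  where
  -- A potential: 2 ^ l * g c never increases. The value 1 at 0 makes the last halving, from 1 to 0,
  -- exact.
  g : ℕ → ℕ
  g zero    = 1
  g (suc c) = 2 * suc c
  g≤ : ∀ c → g c ≤ 1 + 2 * c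
  g≤ zero    = ≤-refl
  g≤ (suc c) = n≤1+n _
  g-half : ∀ c → g ⌊ suc c /2⌋ ≤ suc c
  g-half zero    = ≤-refl
  g-half (suc c) = ≤-trans (≤-reflexive (*-suc 2 ⌊ c /2⌋)) (s≤s (s≤s (2⌊n/2⌋≤n c)))
  go : ∀ k c l → 2 ^ proj₂ (iterate lgStep k (c , l)) ≤ 2 ^ l * g c
  go zero    zero    l = ≤-reflexive (sym (*-identityʳ _))
  go zero    (suc c) l = m≤m*n (2 ^ l) (g (suc c))
  go (suc k) zero    l = go k zero l
  go (suc k) (suc c) l = begin
    _                               ≤⟨ go k ⌊ suc c /2⌋ (suc l) ⟩
    2 * 2 ^ l * g ⌊ suc c /2⌋       ≤⟨ *-monoʳ-≤ (2 * 2 ^ l) (g-half c) ⟩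
    2 * 2 ^ l * suc c               ≡⟨ cong (_* suc c) (*-comm 2 (2 ^ l)) ⟩
    2 ^ l * 2 * suc c               ≡⟨ *-assoc (2 ^ l) 2 (suc c) ⟩
    2 ^ l * g (suc c)               ∎
    where open ≤-Reasoning

size>0 : ∀ t → 1 ≤ size t
size>0 nil     = s≤s z≤n
size>0 (_ ∙ _) = s≤s z≤n

length≤size : (enc : A → Tree) → ∀ xs → length xs ≤ size (encodeList enc xs)
length≤size enc []       = z≤n
length≤size enc (x ∷ xs) = s≤s (≤-trans (length≤size enc xs) (m≤n+m _ (size (enc x))))

size-∈ : (enc : A → Tree) → ∀ {x xs} → x ∈ xs → size (enc x) ≤ size (encodeList enc xs)
size-∈ enc {xs = x ∷ xs} (here refl) = m≤n⇒m≤1+n (m≤m+n _ _)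
size-∈ enc {xs = y ∷ xs} (there i)   = m≤n⇒m≤1+n (≤-trans (size-∈ enc i) (m≤n+m _ (size (enc y))))

digits≤size : ∀ b → digits b ≤ size (encodeBin b)
digits≤size 0ᵇ       = z≤n
digits≤size 2[1+ b ] = s≤s (≤-trans (digits≤size b) (m≤n+m _ 1))
digits≤size 1+[2 b ] = s≤s (≤-trans (digits≤size b) (m≤n+m _ 3))

module Sizes (G : ParityGame) where
  open ParityGame G
  open Game G

  s : ℕ
  s = size (encodeGame G)

  private
    colourSize = size (encodeList encodeℕ C)
    φSize = size (encodeList encodeℕ (tabulate φ))
    ownerSize = size (encodeList encodePlayer (tabulate owner))
    edgeSize = size (encodeList (encodeList encodeBool) (tabulate λ v → tabulate (edge v)))

    tail≤ : ∀ a {b c} → b ≤ c → b ≤ suc (a + c)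
    tail≤ a b≤c = m≤n⇒m≤1+n (≤-trans b≤c (m≤n+m _ a))

  n≤size : n ≤ s
  n≤size = ≤-trans (≤-reflexive (sym (length-tabulate owner)))
    (≤-trans (length≤size encodePlayer (tabulate owner)) (m≤n⇒m≤1+n (m≤m+n ownerSize _)))

  C≤size : length C ≤ s
  C≤size = tail≤ ownerSize (tail≤ edgeSize
    (≤-trans (length≤size encodeℕ C) (m≤n⇒m≤1+n (m≤m+n colourSize φSize))))

  φ≤size : ∀ v → digits (fromℕ (φ v)) ≤ s
  φ≤size v = tail≤ ownerSize (tail≤ edgeSize (tail≤ colourSize
    (≤-trans (digits≤size (fromℕ (φ v))) (size-∈ encodeℕ (∈-tabulate⁺ {f = φ} v)))))

  evenColours≤C : length evenColours ≤ #colours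
  evenColours≤C = length-filter (T? ∘ bad odd) C

  -- A used even colour occurs at an even vertex. This controls the games with fewer than e₀ even
  -- vertices, for which the class says nothing about the number of colours.
  evenColours≤evenVertices : length evenColours ≤ #evenVertices
  evenColours≤evenVertices = ≤-trans
    (unique-⊆-length (Unique.filter⁺ (T? ∘ bad odd) C-unique) covered)
    (≤-reflexive (length-map φ evens))
    where
    evens : List V
    evens = filter (λ v → 2 ∣? φ v) (allFin n)
    covered : ∀ {c} → c ∈ evenColours → c ∈ mapˡ φ evens
    covered {c} c∈ with proj₂ (∈-filter⁻ (T? ∘ bad odd) {xs = C} c∈)
    ... | t with bad-odd⇒ {c} t
    ...   | v , refl = ∈-map⁺ φ (∈-filter⁺ (λ v → 2 ∣? φ v) (∈-allFin v)
                         (does⁻ (2 ∣? φ v) (proj₁ (Equivalence.to T-∧ t))))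

  evenVertices≤n : #evenVertices ≤ n
  evenVertices≤n = ≤-trans (length-filter (λ v → 2 ∣? φ v) (allFin n))
                           (≤-reflexive (length-tabulate {n = n} id))

  -- Few even colours: either c ≤ K log e applies, or fewer than e₀ vertices,
  -- and hence fewer than e₀ colours, are even.
  2^evenColours≤ : ∀ K e₀ → (e₀ ≤ #evenVertices → #colours ≤ K * ⌊log₂ #evenVertices ⌋) →
                   2 ^ length evenColours ≤ 2 ^ e₀ * suc s ^ K
  2^evenColours≤ K e₀ bounded with e₀ ≤? #evenVertices
  ... | no e₀≰e = ≤-trans (^-monoʳ-≤ 2 (≤-trans evenColours≤evenVertices (<⇒≤ (≰⇒> e₀≰e))))
                          (m≤m*n (2 ^ e₀) (suc s ^ K) {{m^n≢0 (suc s) K}})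
  ... | yes e₀≤e = begin
    2 ^ length evenColours          ≤⟨ ^-monoʳ-≤ 2 (≤-trans evenColours≤C (bounded e₀≤e)) ⟩
    2 ^ (K * ⌊log₂ #evenVertices ⌋) ≡⟨ cong (2 ^_) (*-comm K _) ⟩
    2 ^ (⌊log₂ #evenVertices ⌋ * K) ≡⟨ ^-*-assoc 2 ⌊log₂ #evenVertices ⌋ K ⟨
    (2 ^ ⌊log₂ #evenVertices ⌋) ^ K ≤⟨ ^-monoˡ-≤ K (2^⌊log₂n⌋≤1+n #evenVertices) ⟩
    suc #evenVertices ^ K           ≤⟨ ^-monoˡ-≤ K (s≤s (≤-trans evenVertices≤n n≤size)) ⟩
    suc s ^ K                       ≤⟨ m≤n*m (suc s ^ K) (2 ^ e₀) {{m^n≢0 2 e₀}} ⟩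
    2 ^ e₀ * suc s ^ K              ∎
    where open ≤-Reasoning

  3^levels≤ : ∀ {b} → 2 ^ length evenColours ≤ b →
              3 ^ (length evenColours + lg n) ≤ (b * (1 + 2 * s)) * (b * (1 + 2 * s))
  3^levels≤ {b} h≤b = begin
    -- Replacing 3 by 4 = 2 * 2 costs only a squaring and leaves powers of 2, which match the
    -- logarithms.
    3 ^ M                       ≤⟨ ^-monoˡ-≤ M (n≤1+n 3) ⟩
    (2 * 2) ^ M                 ≡⟨ *-^-distrib 2 2 M ⟩
    2 ^ M * 2 ^ M               ≤⟨ *-mono-≤ 2^M≤ 2^M≤ ⟩
    _                           ∎
    where
    open ≤-Reasoning
    M = length evenColours + lg n
    2^M≤ : 2 ^ M ≤ b * (1 + 2 * s)
    2^M≤ = ≤-trans (≤-reflexive (^-distribˡ-+-* 2 (length evenColours) (lg n)))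
      (*-mono-≤ h≤b (≤-trans (2^lg≤ n) (s≤s (*-monoʳ-≤ 2 n≤size))))

-- From terms to polynomial-time programs

poly-≤ : ∀ {f g} → (∀ x → f x ≤ g x) → PolynomiallyBounded g → PolynomiallyBounded f
poly-≤ f≤g (a , d , h) = a , d , λ x → ≤-trans (f≤g x) (h x)

poly-^ : ∀ {f} → PolynomiallyBounded f → ∀ d → PolynomiallyBounded (λ x → f x ^ d)
poly-^ p zero    = poly-const 1
poly-^ p (suc d) = poly-* p (poly-^ p d)

poly-∘ : ∀ {f g} → PolynomiallyBounded f → PolynomiallyBounded g → PolynomiallyBounded (f ∘ g)
poly-∘ {g = g} (a , d , h) q = poly-≤ (h ∘ g) (poly-* (poly-const a) (poly-^ (poly-+ (poly-const 1) q) d))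

toProgram : Term 1 → Program
toProgram t = program {0} (set (cons (var zero) nil) ⨾ compile (const 0) t ⨾ set (hd (var zero)))

programTime : ℕ → Term 1 → ℕ
programTime N t = setTime (cons (var zero) nil) + (time N (const 0) t + setTime (hd (var zero)))

toProgram-correct : ∀ {N t g x} → let open Rules N in (g ∷ []) ⊢ t ⇓ x →
                    ∃[ τ ] (Program.Computes (toProgram t) g x τ × τ ≤ programTime N t)
toProgram-correct {N} {t} {g} d =
  let τ , p , τ≤ = runs-seq (runs-set (cons (var zero) nil) {g})
                     (runs-seq (Correctness.compile-correct N d (const 0) (g ∙ nil) λ { zero → refl })
                               (runs-set (hd (var zero))))
  in τ , (_ , p , refl) , τ≤

-- Unfolding the constants a and d for a concrete term is infeasible.
abstract

  toProgram-polynomial : ∀ t {loops} → PolynomiallyBounded loops →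
    ∃[ a ] ∃[ d ] (∀ {g x} → let open Rules (loops (size g)) in (g ∷ []) ⊢ t ⇓ x →
      ∃[ τ ] (Program.Computes (toProgram t) g x τ × τ ≤ a * size g ^ d))
  -- `suc s` is at most 2 * s, as every tree has positive size; this moves a factor 2 ^ d into the
  -- constant.
  toProgram-polynomial t {loops} p = a * 2 ^ d , d , λ {g} e →
    let s = size g
        τ , computes , τ≤ = toProgram-correct e
    in τ , computes , (begin
      τ                        ≤⟨ τ≤ ⟩
      programTime (loops s) t  ≤⟨ proj₂ (proj₂ poly) s ⟩
      a * suc s ^ d            ≤⟨ *-monoʳ-≤ a (^-monoˡ-≤ d
                                    (+-mono-≤ (size>0 g) (≤-reflexive (sym (+-identityʳ s))))) ⟩
      a * (2 * s) ^ d          ≡⟨ cong (a *_) (*-^-distrib 2 s d) ⟩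
      a * (2 ^ d * s ^ d)      ≡⟨ *-assoc a (2 ^ d) (s ^ d) ⟨
      a * 2 ^ d * s ^ d        ∎)
    where
    open ≤-Reasoning
    entry exit : ℕ
    entry  = setTime (cons (var zero) nil)
    exit = setTime (hd (var zero))
    poly : PolynomiallyBounded (λ s → programTime (loops s) t)
    poly = poly-∘ {λ N → programTime N t} {loops}
      (poly-+ {const entry} {λ N → time N (const 0) t + exit} (poly-const entry)
        (poly-+ {λ N → time N (const 0) t} {const exit} (poly-time (const 0) t) (poly-const exit)))
      p
    a d : ℕ
    a = proj₁ poly
    d = proj₁ (proj₂ poly)

corollary3 : ∀ {ℓ} (𝒞 : Pred ParityGame ℓ) →
    LogBoundedColours 𝒞 → SolvableInPolynomialTime 𝒞
corollary3 𝒞 (K , e₀ , bounded) = toProgram mainT , proj₁ poly , proj₁ (proj₂ poly) , solve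
  where
  b loops : ℕ → ℕ
  -- In `b` the factors 2 ^ e₀ * suc s ^ K bound 2 ^ h, and 1 + 2 * s bounds 2 ^ l. The square of
  -- `b` bounds the number of codes, and the summand s in `loops` the lists in the input.
  b s = 2 ^ e₀ * suc s ^ K * (1 + 2 * s)
  loops s = s + b s * b s

  poly-b : PolynomiallyBounded b
  poly-b = poly-* (poly-* (poly-const (2 ^ e₀)) (poly-^ (poly-+ (poly-const 1) poly-id) K))
                  (poly-+ (poly-const 1) (poly-* (poly-const 2) poly-id))

  poly = toProgram-polynomial mainT {loops} (poly-+ poly-id (poly-* poly-b poly-b))

  solve : ∀ G → 𝒞 G → ∃[ W ] ∃[ t ]
    ( IsSolution G W
    × Program.Computes (toProgram mainT) (encodeGame G) (encodeSolution G W) t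
    × t ≤ proj₁ poly * size (encodeGame G) ^ proj₁ (proj₂ poly) )
  solve G G∈𝒞 =
    let open Sizes G
        open Solver G (loops s) (≤-trans n≤size (m≤m+n s _)) (≤-trans C≤size (m≤m+n s _))
                                (λ v → ≤-trans (φ≤size v) (m≤m+n s _))
        levels≤ = 3^levels≤ (2^evenColours≤ K e₀ (bounded G G∈𝒞))
        t , computes , t≤ = proj₂ (proj₂ poly) (mainᴿ (≤-trans levels≤ (m≤n+m _ s)))
    in Game.W G , t , Game.W-isSolution G ,
       subst (λ x → Program.Computes (toProgram mainT) (encodeGame G) x t)
             (encodeSolution-final (n<2^lg _)) computes ,
       t≤
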